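{- Let $q \geq 7$ be a prime power, and let $F(X) \in \mathbb{F}_q[X]$ be an irreducible polynomial of degree $r \geq 2$. Then every non-zero residue class modulo $F$ contains a polynomial $f \in \mathbb{F}_q[X]$ which is non-constant, square-free, and $(r-1)$-smooth.
   Context: $\mathbb{F}_q$ denotes the finite field with $q$ elements. A polynomial $f \in \mathbb{F}_q[X]$ is called $k$-smooth if it has no irreducible factor of degree exceeding $k$, and square-free if it is not divisible by the square of an irreducible polynomial. -}

module Defs where

open import Level using (0ℓ)
open import Data.Nat using (ℕ; zero; suc; _≤_)
open import Data.Fin using (Fin)
import Data.Fin as Fin
open import Data.List using (List; []; _∷_; map; length)
open import Data.List.Relation.Unary.All using (All)
open import Data.Product using (∃; Σ; _,_)
open import Data.Sum using (_⊎_)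
open import Relation.Nullary using (¬_; Dec; yes; no)
open import Relation.Binary.PropositionalEquality using (_≡_; refl; cong; sym; trans)
open import Algebra.Structures using (IsCommutativeRing)
open import Function.Bundles using (_↔_; Inverse)

record FiniteField : Set₁ where
  infixl 6 _+_
  infixl 7 _*_
  field
    Carrier : Set
    _+_ _*_ : Carrier → Carrier → Carrier
    -_      : Carrier → Carrier
    0# 1#   : Carrier
    isCommutativeRing : IsCommutativeRing _≡_ _+_ _*_ -_ 0# 1#
    0≢1     : ¬ (0# ≡ 1#)
    inverse : ∀ x → ¬ (x ≡ 0#) → ∃ λ y → x * y ≡ 1#
    size    : ℕ
    enum    : Carrier ↔ Fin size

-- Polynomials over a finite field, as lists of coefficients in ascending
-- order of degree (constant coefficient first).  Lists differing only by
-- trailing zeros represent the same polynomial.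
module Polynomials (𝔽 : FiniteField) where
  open FiniteField 𝔽

  _≟_ : (x y : Carrier) → Dec (x ≡ y)
  x ≟ y with Inverse.to enum x Fin.≟ Inverse.to enum y
  ... | yes p = yes (trans (sym (Inverse.strictlyInverseʳ enum x))
                     (trans (cong (Inverse.from enum) p) (Inverse.strictlyInverseʳ enum y)))
  ... | no ¬p = no (λ e → ¬p (cong (Inverse.to enum) e))

  Poly : Set
  Poly = List Carrier

  strip : Poly → Poly
  strip [] = []
  strip (a ∷ p) with strip p | a ≟ 0#
  ... | [] | yes _ = []
  ... | [] | no _  = a ∷ []
  ... | b ∷ s | _  = a ∷ b ∷ s

  -- number of coefficients of the normal form: 0 for the zero polynomial,
  -- deg p + 1 otherwise
  len : Poly → ℕ
  len p = length (strip p)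

  _+ₚ_ : Poly → Poly → Poly
  [] +ₚ q = q
  (a ∷ p) +ₚ [] = a ∷ p
  (a ∷ p) +ₚ (b ∷ q) = (a + b) ∷ (p +ₚ q)

  -ₚ_ : Poly → Poly
  -ₚ p = map -_ p

  _-ₚ_ : Poly → Poly → Poly
  p -ₚ q = p +ₚ (-ₚ q)

  _*ₚ_ : Poly → Poly → Poly
  [] *ₚ q = []
  (a ∷ p) *ₚ q = map (a *_) q +ₚ (0# ∷ (p *ₚ q))

  _≈ₚ_ : Poly → Poly → Set
  p ≈ₚ q = All (_≡ 0#) (p -ₚ q)

  _∣ₚ_ : Poly → Poly → Set
  g ∣ₚ f = Σ Poly λ h → f ≈ₚ (g *ₚ h)

  HasDegree : Poly → ℕ → Set
  HasDegree p d = len p ≡ suc d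

  NonConstant : Poly → Set
  NonConstant p = 2 ≤ len p

  Irreducible : Poly → Set
  Irreducible p = NonConstant p × (∀ g h → p ≈ₚ (g *ₚ h) → len g ≡ 1 ⊎ len h ≡ 1)
    where open import Data.Product using (_×_)

  SquareFree : Poly → Set
  SquareFree f = ∀ p → Irreducible p → ¬ ((p *ₚ p) ∣ₚ f)

  Smooth : ℕ → Poly → Set
  Smooth k f = ∀ p → Irreducible p → p ∣ₚ f → len p ≤ suc k

{-# OPTIONS --safe #-}
module Submission where

-- Pick residues a and b and let c be the residue of g/(ab), so that f = abc lies in the class of g and has
-- only factors of degree < r.  The third residue is determined by the other two, but any two of
-- a, b, c range freely over pairs of residues.  Hence each way in which f can fail to be square-free
-- (one of three factors divisible by a square, or one of three pairs with a common divisor)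
-- is counted without any equidistribution input: listing all monic s with s² ∣ a, or with s ∣ a and s ∣ b,
-- each of the six excludes fewer than a fraction 1/(q - 1) ≤ 1/6 of the q^(2r) pairs, and the
-- savings absorb the pairs containing 0 and the pairs of constants.

open import Defs
open import Level using (0ℓ)
open import Function using (_∘_)
open import Function.Bundles using (Inverse)
import Data.Nat as ℕ
open import Data.Nat using (ℕ; zero; suc; _≤_; _<_; _∸_; _^_; z≤n; s≤s; s≤s⁻¹; _<?_; _≤?_)
import Data.Nat.Properties as ℕₚ
open import Data.Nat.Properties hiding (_≟_; +-assoc; +-comm; +-identityˡ; +-identityʳ; *-assoc; *-comm; *-identityˡ; *-identityʳ)
import Data.Nat.Solver
open import Data.Sum using (_⊎_; inj₁; inj₂)
open import Data.List using (List; []; _∷_; map; length; _++_; tabulate; cartesianProduct; cartesianProductWith)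
open import Data.List.Properties using (length-++; length-map; length-++-sucʳ; length-tabulate)
open import Data.List.Relation.Unary.All using (All; []; _∷_)
import Data.List.Relation.Unary.All as All
import Data.List.Relation.Unary.All.Properties as All
open import Data.List.Relation.Unary.Any using (here; there)
open import Data.List.Relation.Unary.AllPairs using ([]; _∷_)
open import Data.List.Relation.Unary.Unique.Propositional using (Unique)
import Data.List.Relation.Unary.Unique.Propositional.Properties as Unique
open import Data.List.Membership.Propositional using (_∈_; _∉_; find)
open import Data.List.Membership.Propositional.Properties
  using (∈-∃++; ∈-++⁺ˡ; ∈-++⁺ʳ; ∈-++⁻; ∈-map⁺; ∈-cartesianProduct⁺; ∈-cartesianProductWith⁺; ∈-tabulate⁺)
import Data.List.Membership.DecPropositional as DecMembership
open import Data.Vec using (Vec; []; _∷_; toList)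
import Data.Vec.Properties as Vec
open import Data.Product using (Σ; ∃; _×_; _,_; proj₁; proj₂)
import Data.Product.Properties as Product
open import Relation.Nullary using (¬_; yes; no; contradiction)
open import Relation.Binary.Definitions using (DecidableEquality)
open import Relation.Binary.PropositionalEquality
  using (_≡_; _≢_; refl; sym; trans; cong; cong₂; subst; subst₂; module ≡-Reasoning)
open import Algebra.Bundles using (CommutativeRing)
import Algebra.Properties.Ring
import Algebra.Solver.Ring.NaturalCoefficients.Default
import Relation.Binary.Reasoning.Setoid

-- Two factors would not do for this count: with `a` and g/a only one residue is free, and a common
-- divisor `s` of both asks how inverses are spread over the multiples of `s`. With three, each
-- condition involves at most two factors and is a count over all pairs. Both kinds of failure cost
-- the same. There are q^d monic `s` of degree d, and for each, zeros aside, a proportion of at most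
-- q^(-2d) of the pairs has s² ∣ a, or has s ∣ a and s ∣ b. Each kind thus costs at most the sum of
-- q^(-d) over 1 ≤ d < r, just below 1/(q - 1). At q = 7 six full series add up to exactly 1, so
-- what remains is the missing tail d ≥ r: with Q = q^r it is worth qQ of the Q² pairs, against at
-- most 2Q + q² ≤ 3Q pairs that contain a zero or consist of two constants.

private
  variable
    X Y Z : Set

-- Counting with lists: pigeonhole and union bounds.

length-cartesianProductWith : ∀ (f : X → Y → Z) xs ys →
  length (cartesianProductWith f xs ys) ≡ length xs ℕ.* length ys
length-cartesianProductWith f []       ys = refl
length-cartesianProductWith f (x ∷ xs) ys = trans (length-++ (map (f x) ys))
  (cong₂ ℕ._+_ (length-map (f x) ys) (length-cartesianProductWith f xs ys))

-- Pigeonhole by deleting from `ys` one occurrence of each element of `xs`. Repetitions in `ys` are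
-- allowed, so lists of exclusions may overlap and list elements several times.
unique-⊆⇒length≤ : ∀ {xs ys : List X} → Unique xs → (∀ {x} → x ∈ xs → x ∈ ys) → length xs ≤ length ys
unique-⊆⇒length≤ []            sub = z≤n
unique-⊆⇒length≤ {xs = x ∷ xs} (x∉xs ∷ u) sub with ys₁ , ys₂ , refl ← ∈-∃++ (sub (here refl)) =
  ≤-trans (s≤s (unique-⊆⇒length≤ u sub′)) (≤-reflexive (sym (length-++-sucʳ ys₁ x ys₂)))
  where
  sub′ : ∀ {z} → z ∈ xs → z ∈ ys₁ ++ ys₂
  sub′ z∈xs with ∈-++⁻ ys₁ (sub (there z∈xs))
  ... | inj₁ z∈ys₁         = ∈-++⁺ˡ z∈ys₁
  ... | inj₂ (here refl)   = contradiction refl (All.lookup x∉xs z∈xs)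
  ... | inj₂ (there z∈ys₂) = ∈-++⁺ʳ ys₁ z∈ys₂

longer⇒∃∉ : DecidableEquality X → ∀ {xs ys : List X} → Unique xs → length ys < length xs → ∃ λ x → x ∉ ys
longer⇒∃∉ _≟_ {xs} {ys} u short with All.all? (λ x → DecMembership._∈?_ _≟_ x ys) xs
... | yes all⊆ = contradiction (unique-⊆⇒length≤ u (All.lookup all⊆)) (<⇒≱ short)
... | no ¬all⊆ with x , _ , x∉ys ← find (All.¬All⇒Any¬ (λ x → DecMembership._∈?_ _≟_ x ys) xs ¬all⊆) = x , x∉ys

-- The index will be the degree of a divisor. It starts at 1 because the divisor 1, in degree 0,
-- would put everything into the union.
⋃₁ : (ℕ → List X) → ℕ → List X
⋃₁ f zero    = []
⋃₁ f (suc n) = f (suc n) ++ ⋃₁ f n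

∈-⋃₁⁺ : ∀ (f : ℕ → List X) {x d n} → 1 ≤ d → d ≤ n → x ∈ f d → x ∈ ⋃₁ f n
∈-⋃₁⁺ f {n = zero}  1≤d d≤n x∈ = contradiction (≤-trans 1≤d d≤n) λ ()
∈-⋃₁⁺ f {n = suc n} 1≤d d≤n x∈ with m≤n⇒m<n∨m≡n d≤n
... | inj₁ d<1+n = ∈-++⁺ʳ (f (suc n)) (∈-⋃₁⁺ f 1≤d (s≤s⁻¹ d<1+n) x∈)
... | inj₂ refl  = ∈-++⁺ˡ x∈

-- A geometric series in telescoping form: level `suc n` costs at most 6 copies of c q^(r - n - 1),
-- which with the one copy kept as remainder makes 7 ≤ q copies, and these fit into the remainder c
-- q^(r - n) of the previous level. The remainder left at the end is the saving that `union-bound`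
-- spends.
length-⋃₁ : ∀ {q} → 7 ≤ q → ∀ c r (f : ℕ → List X) n → n ≤ r →
  (∀ d → d ≤ n → length (f d) ≤ c ℕ.* q ^ (r ∸ d)) →
  6 ℕ.* length (⋃₁ f n) ℕ.+ c ℕ.* q ^ (r ∸ n) ≤ c ℕ.* q ^ r
length-⋃₁ 7≤q c r f zero    n≤r h = ≤-refl
length-⋃₁ {q = q} 7≤q c r f (suc n) n<r h = begin
  6 ℕ.* length (f (suc n) ++ ⋃₁ f n) ℕ.+ c ℕ.* w
    ≡⟨ cong (λ l → 6 ℕ.* l ℕ.+ c ℕ.* w) (length-++ (f (suc n))) ⟩
  6 ℕ.* (length (f (suc n)) ℕ.+ y) ℕ.+ c ℕ.* w
    ≤⟨ +-monoˡ-≤ (c ℕ.* w) (*-monoʳ-≤ 6 (+-monoˡ-≤ y (h (suc n) ≤-refl))) ⟩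
  6 ℕ.* (c ℕ.* w ℕ.+ y) ℕ.+ c ℕ.* w
    ≡⟨ solve 3 (λ c w y → con 6 :* (c :* w :+ y) :+ c :* w := con 6 :* y :+ c :* (con 7 :* w)) refl c w y ⟩
  6 ℕ.* y ℕ.+ c ℕ.* (7 ℕ.* w)
    ≤⟨ +-monoʳ-≤ (6 ℕ.* y) (*-monoʳ-≤ c (*-monoˡ-≤ w 7≤q)) ⟩
  6 ℕ.* y ℕ.+ c ℕ.* (q ^ suc (r ∸ suc n))
    ≡⟨ cong (λ e → 6 ℕ.* y ℕ.+ c ℕ.* q ^ e) (+-∸-assoc 1 n<r) ⟨
  6 ℕ.* y ℕ.+ c ℕ.* q ^ (r ∸ n)
    ≤⟨ length-⋃₁ 7≤q c r f n (<⇒≤ n<r) (λ d d≤n → h d (m≤n⇒m≤1+n d≤n)) ⟩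
  c ℕ.* q ^ r ∎
  where
  open ≤-Reasoning
  open Data.Nat.Solver.+-*-Solver
  w = q ^ (r ∸ suc n)
  y = length (⋃₁ f n)

-- The summands follow the nine lists of `bad` literally, whence `1 ℕ.* Q` and `Q ℕ.* 1`. Doubling
-- turns the three `x` and three `y` terms into 6x and 6y, so the hypotheses apply and save 2qQ in
-- total; the other terms double to 4Q + 2q² ≤ 6Q, which is less than 2qQ.
union-bound : ∀ {q Q} x y → 7 ≤ q → q ℕ.* q ≤ Q → 6 ℕ.* x ℕ.+ q ≤ Q → 6 ℕ.* y ℕ.+ Q ℕ.* q ≤ Q ℕ.* Q →
  x ℕ.* Q ℕ.+ (Q ℕ.* x ℕ.+ (Q ℕ.* x ℕ.+ (y ℕ.+ (y ℕ.+ (y ℕ.+ (1 ℕ.* Q ℕ.+ (Q ℕ.* 1 ℕ.+ q ℕ.* q))))))) < Q ℕ.* Q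
union-bound {q} {Q} x y 7≤q q²≤Q hx hy = *-cancelˡ-< 2 _ _ (+-cancelʳ-< (2 ℕ.* (q ℕ.* Q)) _ _ (begin-strict
  2 ℕ.* (x ℕ.* Q ℕ.+ (Q ℕ.* x ℕ.+ (Q ℕ.* x ℕ.+ (y ℕ.+ (y ℕ.+ (y ℕ.+ (1 ℕ.* Q ℕ.+ (Q ℕ.* 1 ℕ.+ q ℕ.* q)))))))) ℕ.+ 2 ℕ.* (q ℕ.* Q)
    ≡⟨ solve 4 (λ x y q Q → con 2 :* (x :* Q :+ (Q :* x :+ (Q :* x :+ (y :+ (y :+ (y :+ (con 1 :* Q :+ (Q :* con 1 :+ q :* q)))))))) :+ con 2 :* (q :* Q)
         := (con 6 :* x :+ q) :* Q :+ (con 6 :* y :+ Q :* q) :+ (con 4 :* Q :+ con 2 :* (q :* q))) refl x y q Q ⟩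
  (6 ℕ.* x ℕ.+ q) ℕ.* Q ℕ.+ (6 ℕ.* y ℕ.+ Q ℕ.* q) ℕ.+ (4 ℕ.* Q ℕ.+ 2 ℕ.* (q ℕ.* q))
    ≤⟨ +-mono-≤ (+-mono-≤ (*-monoˡ-≤ Q hx) hy) (+-monoʳ-≤ (4 ℕ.* Q) (*-monoʳ-≤ 2 q²≤Q)) ⟩
  Q ℕ.* Q ℕ.+ Q ℕ.* Q ℕ.+ (4 ℕ.* Q ℕ.+ 2 ℕ.* Q)
    ≡⟨ solve 1 (λ Q → Q :* Q :+ Q :* Q :+ (con 4 :* Q :+ con 2 :* Q) := con 2 :* (Q :* Q) :+ con 6 :* Q) refl Q ⟩
  2 ℕ.* (Q ℕ.* Q) ℕ.+ 6 ℕ.* Q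
    <⟨ +-monoʳ-< (2 ℕ.* (Q ℕ.* Q)) 6Q<2qQ ⟩
  2 ℕ.* (Q ℕ.* Q) ℕ.+ 2 ℕ.* (q ℕ.* Q) ∎))
  where
  open ≤-Reasoning
  open Data.Nat.Solver.+-*-Solver
  0<Q : 0 < Q
  0<Q = ≤-trans (≤-trans (s≤s z≤n) (*-mono-≤ 7≤q 7≤q)) q²≤Q
  6Q<2qQ : 6 ℕ.* Q < 2 ℕ.* (q ℕ.* Q)
  6Q<2qQ = begin-strict
    6 ℕ.* Q            <⟨ *-monoˡ-< Q {{ℕ.>-nonZero 0<Q}} (n<1+n 6) ⟩
    7 ℕ.* Q            ≤⟨ *-monoˡ-≤ Q 7≤q ⟩
    q ℕ.* Q            ≤⟨ m≤m+n _ _ ⟩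
    2 ℕ.* (q ℕ.* Q)    ∎

module PolynomialRing (𝔽 : FiniteField) where
  open FiniteField 𝔽
  open Polynomials 𝔽

  field-ring : CommutativeRing 0ℓ 0ℓ
  field-ring = record { isCommutativeRing = isCommutativeRing }

  open CommutativeRing field-ring
    using (+-assoc; +-comm; +-identityˡ; +-identityʳ; -‿inverseˡ; -‿inverseʳ;
           *-assoc; *-comm; *-identityˡ; *-identityʳ; zeroˡ; zeroʳ; distribˡ; ring; commutativeSemiring)
  open Algebra.Properties.Ring ring using (-0#≈0#; x∙y⁻¹≈ε⇒x≈y)
  open Algebra.Solver.Ring.NaturalCoefficients.Default commutativeSemiring
    using (solve; _:+_; _:*_; _:=_)

  -- Polynomials up to trailing zeros as a commutative ring.

  coef : Poly → ℕ → Carrier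
  coef []      _       = 0#
  coef (a ∷ _) zero    = a
  coef (_ ∷ p) (suc n) = coef p n

  infix 4 _≐_

  -- Coefficientwise equality is visibly an equivalence, unlike the vanishing of a difference in
  -- `_≈ₚ_`. The record wrapper lets `p` and `q` be inferred from a proof.
  record _≐_ (p q : Poly) : Set where
    constructor coefwise
    field at : ∀ n → coef p n ≡ coef q n
  open _≐_

  infixl 6 _⊕_
  infixl 7 _⊛_
  _⊕_ _⊛_ : Poly → Poly → Poly
  _⊕_ = _+ₚ_
  _⊛_ = _*ₚ_

  infixl 7 _·_
  _·_ : Carrier → Poly → Poly
  c · p = map (c *_) p

  coef-+ : ∀ p q n → coef (p ⊕ q) n ≡ coef p n + coef q n
  coef-+ []      q       n       = sym (+-identityˡ _)
  coef-+ (a ∷ p) []      n       = sym (+-identityʳ _)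
  coef-+ (a ∷ p) (b ∷ q) zero    = refl
  coef-+ (a ∷ p) (b ∷ q) (suc n) = coef-+ p q n

  coef-neg : ∀ p n → coef (-ₚ p) n ≡ - coef p n
  coef-neg []      n       = sym -0#≈0#
  coef-neg (a ∷ p) zero    = refl
  coef-neg (a ∷ p) (suc n) = coef-neg p n

  coef-· : ∀ c p n → coef (c · p) n ≡ c * coef p n
  coef-· c []      n       = sym (zeroʳ c)
  coef-· c (a ∷ p) zero    = refl
  coef-· c (a ∷ p) (suc n) = coef-· c p n

  ≐-refl : ∀ {p} → p ≐ p
  ≐-refl = coefwise λ _ → refl

  ≐-sym : ∀ {p q} → p ≐ q → q ≐ p
  ≐-sym e = coefwise λ n → sym (at e n)

  ≐-trans : ∀ {p q s} → p ≐ q → q ≐ s → p ≐ s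
  ≐-trans e f = coefwise λ n → trans (at e n) (at f n)

  ∷-cong : ∀ {a b p q} → a ≡ b → p ≐ q → a ∷ p ≐ b ∷ q
  ∷-cong e f = coefwise λ { zero → e ; (suc n) → at f n }

  0∷[]≐[] : 0# ∷ [] ≐ []
  0∷[]≐[] = coefwise λ { zero → refl ; (suc _) → refl }

  ⊕-cong : ∀ {p p′ q q′} → p ≐ p′ → q ≐ q′ → p ⊕ q ≐ p′ ⊕ q′
  ⊕-cong {p} {p′} {q} {q′} e f = coefwise λ n →
    trans (coef-+ p q n) (trans (cong₂ _+_ (at e n) (at f n)) (sym (coef-+ p′ q′ n)))

  neg-cong : ∀ {p q} → p ≐ q → -ₚ p ≐ -ₚ q
  neg-cong {p} {q} e = coefwise λ n →
    trans (coef-neg p n) (trans (cong -_ (at e n)) (sym (coef-neg q n)))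

  ·-cong : ∀ {a b p q} → a ≡ b → p ≐ q → a · p ≐ b · q
  ·-cong {a} {b} {p} {q} e f = coefwise λ n →
    trans (coef-· a p n) (trans (cong₂ _*_ e (at f n)) (sym (coef-· b q n)))

  ⊕-assoc : ∀ p q s → (p ⊕ q) ⊕ s ≐ p ⊕ (q ⊕ s)
  ⊕-assoc p q s = coefwise λ n → begin
    coef ((p ⊕ q) ⊕ s) n            ≡⟨ coef-+ (p ⊕ q) s n ⟩
    coef (p ⊕ q) n + coef s n       ≡⟨ cong (_+ coef s n) (coef-+ p q n) ⟩
    coef p n + coef q n + coef s n  ≡⟨ +-assoc _ _ _ ⟩
    coef p n + (coef q n + coef s n) ≡⟨ cong (coef p n +_) (coef-+ q s n) ⟨
    coef p n + coef (q ⊕ s) n       ≡⟨ coef-+ p (q ⊕ s) n ⟨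
    coef (p ⊕ (q ⊕ s)) n            ∎
    where open ≡-Reasoning

  ⊕-comm : ∀ p q → p ⊕ q ≐ q ⊕ p
  ⊕-comm p q = coefwise λ n → trans (coef-+ p q n) (trans (+-comm _ _) (sym (coef-+ q p n)))

  ⊕-identityˡ : ∀ p → [] ⊕ p ≐ p
  ⊕-identityˡ p = ≐-refl

  ⊕-identityʳ : ∀ p → p ⊕ [] ≐ p
  ⊕-identityʳ p = ⊕-comm p []

  ⊕-inverseˡ : ∀ p → (-ₚ p) ⊕ p ≐ []
  ⊕-inverseˡ p = coefwise λ n →
    trans (coef-+ (-ₚ p) p n) (trans (cong (_+ coef p n) (coef-neg p n)) (-‿inverseˡ _))

  ⊕-inverseʳ : ∀ p → p ⊕ (-ₚ p) ≐ []
  ⊕-inverseʳ p = ≐-trans (⊕-comm p (-ₚ p)) (⊕-inverseˡ p)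

  ⊕-interchange : ∀ p q s t → (p ⊕ q) ⊕ (s ⊕ t) ≐ (p ⊕ s) ⊕ (q ⊕ t)
  ⊕-interchange p q s t = coefwise λ n → begin
    coef ((p ⊕ q) ⊕ (s ⊕ t)) n                          ≡⟨ coef-++ p q s t n ⟩
    (coef p n + coef q n) + (coef s n + coef t n)       ≡⟨ solve 4 (λ a b c d → (a :+ b) :+ (c :+ d) := (a :+ c) :+ (b :+ d)) refl _ _ _ _ ⟩
    (coef p n + coef s n) + (coef q n + coef t n)       ≡⟨ coef-++ p s q t n ⟨
    coef ((p ⊕ s) ⊕ (q ⊕ t)) n ∎
    where
    open ≡-Reasoning
    coef-++ : ∀ p q s t n → coef ((p ⊕ q) ⊕ (s ⊕ t)) n ≡ (coef p n + coef q n) + (coef s n + coef t n)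
    coef-++ p q s t n = trans (coef-+ (p ⊕ q) (s ⊕ t) n) (cong₂ _+_ (coef-+ p q n) (coef-+ s t n))

  ·-distrib-⊕ : ∀ c p q → c · (p ⊕ q) ≐ c · p ⊕ c · q
  ·-distrib-⊕ c p q = coefwise λ n → begin
    coef (c · (p ⊕ q)) n              ≡⟨ coef-· c (p ⊕ q) n ⟩
    c * coef (p ⊕ q) n                ≡⟨ cong (c *_) (coef-+ p q n) ⟩
    c * (coef p n + coef q n)         ≡⟨ distribˡ _ _ _ ⟩
    c * coef p n + c * coef q n       ≡⟨ cong₂ _+_ (coef-· c p n) (coef-· c q n) ⟨
    coef (c · p) n + coef (c · q) n   ≡⟨ coef-+ (c · p) (c · q) n ⟨
    coef (c · p ⊕ c · q) n            ∎
    where open ≡-Reasoning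

  ·-· : ∀ c d p → c · (d · p) ≐ (c * d) · p
  ·-· c d p = coefwise λ n →
    trans (coef-· c (d · p) n) (trans (cong (c *_) (coef-· d p n))
      (trans (sym (*-assoc c d _)) (sym (coef-· (c * d) p n))))

  1·_ : ∀ p → 1# · p ≐ p
  1· p = coefwise λ n → trans (coef-· 1# p n) (*-identityˡ _)

  0·_ : ∀ p → 0# · p ≐ []
  0· p = coefwise λ n → trans (coef-· 0# p n) (zeroˡ _)

  ⊛-zeroʳ : ∀ p → p ⊛ [] ≐ []
  ⊛-zeroʳ []      = ≐-refl
  ⊛-zeroʳ (a ∷ p) = ≐-trans (∷-cong refl (⊛-zeroʳ p)) 0∷[]≐[]

  ⊛-congʳ : ∀ p {q q′} → q ≐ q′ → p ⊛ q ≐ p ⊛ q′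
  ⊛-congʳ []      e = ≐-refl
  ⊛-congʳ (a ∷ p) e = ⊕-cong (·-cong refl e) (∷-cong refl (⊛-congʳ p e))

  -- The recursion of `_*ₚ_` mirrored to the right factor. It makes commutativity an induction, and
  -- commutativity then transports each one-sided law to the other side.
  ⊛-∷ʳ : ∀ p b q → p ⊛ (b ∷ q) ≐ b · p ⊕ (0# ∷ p ⊛ q)
  ⊛-∷ʳ []      b q = ≐-sym 0∷[]≐[]
  ⊛-∷ʳ (a ∷ p) b q = ∷-cong (cong (_+ 0#) (*-comm a b))
    (≐-trans (⊕-cong (≐-refl {a · q}) (⊛-∷ʳ p b q))
    (≐-trans (≐-sym (⊕-assoc (a · q) (b · p) _))
    (≐-trans (⊕-cong (⊕-comm (a · q) (b · p)) ≐-refl)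
             (⊕-assoc (b · p) (a · q) _))))

  ⊛-comm : ∀ p q → p ⊛ q ≐ q ⊛ p
  ⊛-comm []      q = ≐-sym (⊛-zeroʳ q)
  ⊛-comm (a ∷ p) q = ≐-trans (⊕-cong (≐-refl {a · q}) (∷-cong refl (⊛-comm p q))) (≐-sym (⊛-∷ʳ q a p))

  ⊛-congˡ : ∀ {p p′} q → p ≐ p′ → p ⊛ q ≐ p′ ⊛ q
  ⊛-congˡ {p} {p′} q e = ≐-trans (⊛-comm p q) (≐-trans (⊛-congʳ q e) (⊛-comm q p′))

  ⊛-cong : ∀ {p p′ q q′} → p ≐ p′ → q ≐ q′ → p ⊛ q ≐ p′ ⊛ q′
  ⊛-cong {p′ = p′} {q = q} e f = ≐-trans (⊛-congˡ q e) (⊛-congʳ p′ f)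

  ⊛-distribˡ : ∀ p q s → p ⊛ (q ⊕ s) ≐ p ⊛ q ⊕ p ⊛ s
  ⊛-distribˡ []      q s = ≐-refl
  ⊛-distribˡ (a ∷ p) q s = ≐-trans
    (⊕-cong (·-distrib-⊕ a q s) (≐-trans (∷-cong (sym (+-identityˡ 0#)) (⊛-distribˡ p q s)) ≐-refl))
    (⊕-interchange (a · q) (a · s) (0# ∷ p ⊛ q) (0# ∷ p ⊛ s))

  ⊛-distribʳ : ∀ p q s → (q ⊕ s) ⊛ p ≐ q ⊛ p ⊕ s ⊛ p
  ⊛-distribʳ p q s = ≐-trans (⊛-comm (q ⊕ s) p)
    (≐-trans (⊛-distribˡ p q s) (⊕-cong (⊛-comm p q) (⊛-comm p s)))

  ·-⊛ : ∀ c p q → (c · p) ⊛ q ≐ c · (p ⊛ q)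
  ·-⊛ c []      q = ≐-refl
  ·-⊛ c (a ∷ p) q = ≐-trans
    (⊕-cong (≐-sym (·-· c a q)) (∷-cong (sym (zeroʳ c)) (·-⊛ c p q)))
    (≐-sym (·-distrib-⊕ c (a · q) (0# ∷ p ⊛ q)))

  0∷-⊛ : ∀ p q → (0# ∷ p) ⊛ q ≐ 0# ∷ p ⊛ q
  0∷-⊛ p q = ⊕-cong (0· q) ≐-refl

  ⊛-assoc : ∀ p q s → (p ⊛ q) ⊛ s ≐ p ⊛ (q ⊛ s)
  ⊛-assoc []      q s = ≐-refl
  ⊛-assoc (a ∷ p) q s = ≐-trans (⊛-distribʳ s (a · q) (0# ∷ p ⊛ q))
    (⊕-cong (·-⊛ a q s) (≐-trans (0∷-⊛ (p ⊛ q) s) (∷-cong refl (⊛-assoc p q s))))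

  const : Carrier → Poly
  const c = c ∷ []

  const-⊛ : ∀ c p → const c ⊛ p ≐ c · p
  const-⊛ c p = ≐-trans (⊕-cong (≐-refl {c · p}) 0∷[]≐[]) (⊕-identityʳ (c · p))

  𝟙 : Poly
  𝟙 = const 1#

  ⊛-identityˡ : ∀ p → 𝟙 ⊛ p ≐ p
  ⊛-identityˡ p = ≐-trans (const-⊛ 1# p) (1· p)

  poly-ring : CommutativeRing 0ℓ 0ℓ
  poly-ring = record
    { Carrier = Poly ; _≈_ = _≐_ ; _+_ = _⊕_ ; _*_ = _⊛_ ; -_ = -ₚ_ ; 0# = [] ; 1# = 𝟙
    ; isCommutativeRing = record
      { isRing = record
        { +-isAbelianGroup = record
          { isGroup = record
            { isMonoid = record
              { isSemigroup = record
                { isMagma = record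
                  { isEquivalence = record { refl = ≐-refl ; sym = ≐-sym ; trans = ≐-trans }
                  ; ∙-cong = ⊕-cong }
                ; assoc = ⊕-assoc }
              ; identity = ⊕-identityˡ , ⊕-identityʳ }
            ; inverse = ⊕-inverseˡ , ⊕-inverseʳ
            ; ⁻¹-cong = neg-cong }
          ; comm = ⊕-comm }
        ; *-cong = ⊛-cong
        ; *-assoc = ⊛-assoc
        ; *-identity = ⊛-identityˡ , (λ p → ≐-trans (⊛-comm p 𝟙) (⊛-identityˡ p))
        ; distrib = ⊛-distribˡ , ⊛-distribʳ }
      ; *-comm = ⊛-comm } }

  ≈ₚ⇒≐ : ∀ p q → p ≈ₚ q → p ≐ q
  ≈ₚ⇒≐ p q zs = coefwise λ n → x∙y⁻¹≈ε⇒x≈y _ _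
    (trans (cong (coef p n +_) (sym (coef-neg q n))) (trans (sym (coef-+ p (-ₚ q) n)) (vanish zs n)))
    where
    vanish : ∀ {u} → All (_≡ 0#) u → ∀ n → coef u n ≡ 0#
    vanish []       n       = refl
    vanish (z ∷ zs) zero    = z
    vanish (z ∷ zs) (suc n) = vanish zs n

  ≐⇒≈ₚ : ∀ p q → p ≐ q → p ≈ₚ q
  ≐⇒≈ₚ p q e = vanish (p -ₚ q) λ n → trans (coef-+ p (-ₚ q) n)
    (trans (cong₂ _+_ (at e n) (coef-neg q n)) (-‿inverseʳ _))
    where
    vanish : ∀ u → (∀ n → coef u n ≡ 0#) → All (_≡ 0#) u
    vanish []      z = []
    vanish (a ∷ u) z = z 0 ∷ vanish u (λ n → z (suc n))

  open CommutativeRing poly-ring using () renaming (setoid to poly-setoid; commutativeSemiring to poly-semiring)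
  module ≐-Reasoning = Relation.Binary.Reasoning.Setoid poly-setoid
  module PS = Algebra.Solver.Ring.NaturalCoefficients.Default poly-semiring

  -- Degrees and division with remainder.

  Below : Poly → ℕ → Set
  Below p n = ∀ m → n ≤ m → coef p m ≡ 0#

  record Deg (p : Poly) (d : ℕ) : Set where
    constructor deg
    field
      lead≢0 : coef p d ≢ 0#
      below  : Below p (suc d)
  open Deg

  Below-resp-≐ : ∀ {p q n} → p ≐ q → Below p n → Below q n
  Below-resp-≐ e b m n≤m = trans (sym (at e m)) (b m n≤m)

  Deg-resp-≐ : ∀ {p q d} → p ≐ q → Deg p d → Deg q d
  Deg-resp-≐ {d = d} e (deg l b) = deg (λ z → l (trans (at e d) z)) (Below-resp-≐ e b)

  Below-mono : ∀ {p m n} → m ≤ n → Below p m → Below p n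
  Below-mono m≤n b k n≤k = b k (≤-trans m≤n n≤k)

  Below-zero : ∀ {p} → Below p 0 → p ≐ []
  Below-zero b = coefwise λ n → b n z≤n

  Deg⇒< : ∀ {p d n} → Deg p d → Below p n → d < n
  Deg⇒< {d = d} {n} D b with d <? n
  ... | yes d<n = d<n
  ... | no  d≮n = contradiction (b d (≮⇒≥ d≮n)) (lead≢0 D)

  Deg-unique : ∀ {p d e} → Deg p d → Deg p e → d ≡ e
  Deg-unique D E = ≤-antisym (s≤s⁻¹ (Deg⇒< D (below E))) (s≤s⁻¹ (Deg⇒< E (below D)))

  Deg⇒≢0 : ∀ {p d} → Deg p d → ¬ (p ≐ [])
  Deg⇒≢0 D e = lead≢0 D (at e _)

  -- The only place where `strip` is analysed; from here on `len` is handled through `Deg`.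
  len-view : ∀ p → (p ≐ [] × len p ≡ 0) ⊎ (∃ λ d → len p ≡ suc d × Deg p d)
  len-view []      = inj₁ (≐-refl , refl)
  len-view (a ∷ p) with strip p | a ≟ 0# | len-view p
  ... | []    | yes a≡0 | inj₁ (p≐0 , _)      = inj₁ (≐-trans (∷-cong a≡0 p≐0) 0∷[]≐[] , refl)
  ... | []    | no  a≢0 | inj₁ (p≐0 , _)      = inj₂ (0 , refl , deg a≢0 λ { (suc m) _ → at p≐0 m })
  ... | _ ∷ _ | yes _   | inj₂ (d , e , deg l b) = inj₂ (suc d , cong suc e , deg l λ { (suc m) (s≤s h) → b m h })
  ... | _ ∷ _ | no  _   | inj₂ (d , e , deg l b) = inj₂ (suc d , cong suc e , deg l λ { (suc m) (s≤s h) → b m h })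

  len⇒Deg : ∀ {p d} → len p ≡ suc d → Deg p d
  len⇒Deg {p} e with len-view p
  ... | inj₁ (_ , e₀) = contradiction (trans (sym e₀) e) λ ()
  ... | inj₂ (_ , e′ , D) = subst (Deg p) (suc-injective (trans (sym e′) e)) D

  Deg⇒len : ∀ {p d} → Deg p d → len p ≡ suc d
  Deg⇒len {p} D with len-view p
  ... | inj₁ (p≐0 , _) = contradiction p≐0 (Deg⇒≢0 D)
  ... | inj₂ (_ , e , E) = trans e (cong suc (Deg-unique E D))

  zero-or-Deg : ∀ p → p ≐ [] ⊎ ∃ (Deg p)
  zero-or-Deg p with len-view p
  ... | inj₁ (p≐0 , _)   = inj₁ p≐0
  ... | inj₂ (d , _ , D) = inj₂ (d , D)

  *-nonzero : ∀ {a b} → a ≢ 0# → b ≢ 0# → a * b ≢ 0#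
  *-nonzero {a} {b} a≢0 b≢0 ab≡0 with inverse a a≢0
  ... | a⁻¹ , aa⁻¹≡1 = b≢0 (begin
    b               ≡⟨ *-identityˡ b ⟨
    1# * b          ≡⟨ cong (_* b) aa⁻¹≡1 ⟨
    a * a⁻¹ * b     ≡⟨ solve 3 (λ x y z → x :* y :* z := y :* (x :* z)) refl a a⁻¹ b ⟩
    a⁻¹ * (a * b)   ≡⟨ cong (a⁻¹ *_) ab≡0 ⟩
    a⁻¹ * 0#        ≡⟨ zeroʳ a⁻¹ ⟩
    0#              ∎)
    where open ≡-Reasoning

  Below-⊕ : ∀ {p q n} → Below p n → Below q n → Below (p ⊕ q) n
  Below-⊕ {p} {q} b c m h = trans (coef-+ p q m) (trans (cong₂ _+_ (b m h) (c m h)) (+-identityˡ 0#))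

  Below-neg : ∀ {p n} → Below p n → Below (-ₚ p) n
  Below-neg {p} b m h = trans (coef-neg p m) (trans (cong -_ (b m h)) -0#≈0#)

  Below-∷ : ∀ {a p n} → Below p n → Below (a ∷ p) (suc n)
  Below-∷ b (suc m) (s≤s h) = b m h

  -- The bound is strict for `p` and weak for `q`, so that the strict bound for the product is
  -- `m ℕ.+ e` with no subtraction, and `m` = 0 covers the zero polynomial.
  Below-⊛ : ∀ p q {m e} → Below p m → Below q (suc e) → Below (p ⊛ q) (m ℕ.+ e)
  Below-⊛ []      q b c n h = refl
  Below-⊛ (a ∷ p) q {zero} b c n h = at (⊛-congˡ q (Below-zero {a ∷ p} b)) n
  Below-⊛ (a ∷ p) q {suc m} {e} b c (suc n) (s≤s h) = begin
    coef (a · q ⊕ (0# ∷ p ⊛ q)) (suc n)   ≡⟨ coef-+ (a · q) _ (suc n) ⟩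
    coef (a · q) (suc n) + coef (p ⊛ q) n ≡⟨ cong₂ _+_ (coef-· a q (suc n)) (Below-⊛ p q (λ k j → b (suc k) (s≤s j)) c n h) ⟩
    a * coef q (suc n) + 0#               ≡⟨ cong (λ x → a * x + 0#) (c (suc n) (s≤s (≤-trans (m≤n+m e m) h))) ⟩
    a * 0# + 0#                           ≡⟨ trans (+-identityʳ _) (zeroʳ a) ⟩
    0#                                    ∎
    where open ≡-Reasoning

  coef-⊛-top : ∀ p q {d e} → Below p (suc d) → Below q (suc e) →
               coef (p ⊛ q) (d ℕ.+ e) ≡ coef p d * coef q e
  coef-⊛-top []      q b c = sym (zeroˡ _)
  coef-⊛-top (a ∷ p) q {zero} {e} b c = begin
    coef (a · q ⊕ (0# ∷ p ⊛ q)) e  ≡⟨ at (⊕-cong (≐-refl {a · q}) (∷-cong refl (⊛-congˡ q (Below-zero {p} λ n _ → b (suc n) (s≤s z≤n))))) e ⟩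
    coef (a · q ⊕ (0# ∷ [])) e     ≡⟨ at (⊕-cong (≐-refl {a · q}) 0∷[]≐[]) e ⟩
    coef (a · q ⊕ []) e            ≡⟨ at (⊕-identityʳ (a · q)) e ⟩
    coef (a · q) e                 ≡⟨ coef-· a q e ⟩
    a * coef q e                   ∎
    where open ≡-Reasoning
  coef-⊛-top (a ∷ p) q {suc d} {e} b c = begin
    coef (a · q ⊕ (0# ∷ p ⊛ q)) (suc (d ℕ.+ e))           ≡⟨ coef-+ (a · q) _ (suc (d ℕ.+ e)) ⟩
    coef (a · q) (suc (d ℕ.+ e)) + coef (p ⊛ q) (d ℕ.+ e) ≡⟨ cong₂ _+_ (coef-· a q (suc (d ℕ.+ e)))
                                                              (coef-⊛-top p q (λ k h → b (suc k) (s≤s h)) c) ⟩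
    a * coef q (suc (d ℕ.+ e)) + coef p d * coef q e      ≡⟨ cong (λ x → a * x + coef p d * coef q e) (c (suc (d ℕ.+ e)) (s≤s (m≤n+m e d))) ⟩
    a * 0# + coef p d * coef q e                          ≡⟨ trans (cong (_+ coef p d * coef q e) (zeroʳ a)) (+-identityˡ _) ⟩
    coef p d * coef q e                                   ∎
    where open ≡-Reasoning

  Deg-⊛ : ∀ {p q d e} → Deg p d → Deg q e → Deg (p ⊛ q) (d ℕ.+ e)
  Deg-⊛ {p} {q} D E = deg
    (λ z → *-nonzero (lead≢0 D) (lead≢0 E) (trans (sym (coef-⊛-top p q (below D) (below E))) z))
    (Below-⊛ p q (below D) (below E))

  -- Division by recursion on the list, in the manner of Horner: if u = QM + R, then a + Xu = (XQ)M
  -- + (a + XR). The new remainder `N` has degree at most `d`, and one subtraction of `t · M`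
  -- removes its coefficient at `d`.
  divide : ∀ {M d} → Deg M d → ∀ u → ∃ λ Q → ∃ λ R → u ≐ Q ⊛ M ⊕ R × Below R d
  divide         D []      = [] , [] , ≐-refl , λ _ _ → refl
  divide {M} {d} D (a ∷ u) with divide D u | inverse (coef M d) (lead≢0 D)
  ... | Q , R , u≐QM+R , R<d | l⁻¹ , ll⁻¹≡1 = t ∷ Q , N ⊕ (-ₚ (t · M)) , eq , small
    where
    N = a ∷ R
    t = coef N d * l⁻¹
    eq : a ∷ u ≐ (t · M ⊕ (0# ∷ Q ⊛ M)) ⊕ (N ⊕ (-ₚ (t · M)))
    eq = ≐-sym (begin
      (t · M ⊕ (0# ∷ Q ⊛ M)) ⊕ (N ⊕ (-ₚ (t · M)))  ≈⟨ ⊕-cong (≐-refl {t · M ⊕ (0# ∷ Q ⊛ M)}) (⊕-comm N (-ₚ (t · M))) ⟩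
      (t · M ⊕ (0# ∷ Q ⊛ M)) ⊕ ((-ₚ (t · M)) ⊕ N)  ≈⟨ ⊕-interchange (t · M) _ (-ₚ (t · M)) N ⟩
      (t · M ⊕ (-ₚ (t · M))) ⊕ ((0# ∷ Q ⊛ M) ⊕ N)  ≈⟨ ⊕-cong (⊕-inverseʳ (t · M)) ≐-refl ⟩
      (0# ∷ Q ⊛ M) ⊕ N                             ≈⟨ ∷-cong (+-identityˡ a) ≐-refl ⟩
      a ∷ (Q ⊛ M ⊕ R)                              ≈⟨ ∷-cong refl (≐-sym u≐QM+R) ⟩
      a ∷ u                                        ∎)
      where open ≐-Reasoning
    small : Below (N ⊕ (-ₚ (t · M))) d
    small m d≤m with m≤n⇒m<n∨m≡n d≤m
    ... | inj₁ d<m = Below-⊕ {N} { -ₚ (t · M)} (Below-∷ {a} {R} R<d) (Below-neg {t · M} λ k h → trans (coef-· t M k) (trans (cong (t *_) (below D k h)) (zeroʳ t))) m d<m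
    ... | inj₂ refl = begin
      coef (N ⊕ (-ₚ (t · M))) d                 ≡⟨ coef-+ N (-ₚ (t · M)) d ⟩
      coef N d + coef (-ₚ (t · M)) d            ≡⟨ cong (coef N d +_) (trans (coef-neg (t · M) d) (cong -_ (coef-· t M d))) ⟩
      coef N d + - (coef N d * l⁻¹ * coef M d)  ≡⟨ cong (λ x → coef N d + - x) (trans (*-assoc _ _ _) (trans (cong (coef N d *_) (trans (*-comm l⁻¹ _) ll⁻¹≡1)) (*-identityʳ _))) ⟩
      coef N d + - coef N d                     ≡⟨ -‿inverseʳ _ ⟩
      0#                                        ∎
      where open ≡-Reasoning

  -- Divisibility, the Euclidean algorithm and irreducible factors.

  infix 4 _∣_
  record _∣_ (p u : Poly) : Set where
    constructor _,_
    field
      quotient : Poly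
      equality : u ≐ p ⊛ quotient

  ∣⇒∣ₚ : ∀ {p u} → p ∣ u → p ∣ₚ u
  ∣⇒∣ₚ {p} {u} (h , e) = h , ≐⇒≈ₚ u (p ⊛ h) e

  ∣ₚ⇒∣ : ∀ {p u} → p ∣ₚ u → p ∣ u
  ∣ₚ⇒∣ {p} {u} (h , e) = h , ≈ₚ⇒≐ u (p ⊛ h) e

  ∣-resp-≐ : ∀ {p u v} → u ≐ v → p ∣ u → p ∣ v
  ∣-resp-≐ e (h , u≐ph) = h , ≐-trans (≐-sym e) u≐ph

  ∣-⊛ : ∀ {p u} v → p ∣ u → p ∣ u ⊛ v
  ∣-⊛ {p} v (h , e) = h ⊛ v , ≐-trans (⊛-congˡ v e) (⊛-assoc p h v)

  ∣-⊕ : ∀ {p u v} → p ∣ u → p ∣ v → p ∣ u ⊕ v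
  ∣-⊕ {p} (h , e) (k , f) = h ⊕ k , ≐-trans (⊕-cong e f) (≐-sym (⊛-distribˡ p h k))

  ∣-refl : ∀ {p} → p ∣ p
  ∣-refl {p} = 𝟙 , ≐-sym (≐-trans (⊛-comm p 𝟙) (⊛-identityˡ p))

  ∣-[] : ∀ {p} → p ∣ []
  ∣-[] {p} = [] , ≐-sym (⊛-zeroʳ p)

  -- Euclid's algorithm with `n` as fuel: a non-zero `v` of degree `d` < `suc n` leaves a remainder
  -- below `d` ≤ `n`. The combination equal to `G` makes this common divisor a greatest one.
  bezout : ∀ n u v → Below v n →
           ∃ λ G → G ∣ u × G ∣ v × ∃ λ s → ∃ λ t → s ⊛ u ⊕ t ⊛ v ≐ G
  bezout n u v b with zero-or-Deg v
  bezout n u v b | inj₁ v≐0 =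
    u , ∣-refl , ∣-resp-≐ (≐-sym v≐0) ∣-[] , 𝟙 , [] , ≐-trans (⊕-identityʳ (𝟙 ⊛ u)) (⊛-identityˡ u)
  bezout zero    u v b | inj₂ (d , D) = contradiction (Below-zero {v} b) (Deg⇒≢0 D)
  bezout (suc n) u v b | inj₂ (d , D)
    with Q , R , u≐Qv+R , R<d ← divide D u
    with G , G∣v , G∣R , s , t , e ← bezout n v R (Below-mono {R} (s≤s⁻¹ (Deg⇒< D b)) R<d)
    = G , G∣u , G∣v , t , s ⊕ t ⊛ (-ₚ Q) , comb
    where
    G∣u : G ∣ u
    G∣u = ∣-resp-≐ (≐-sym u≐Qv+R) (∣-⊕ (∣-resp-≐ (⊛-comm v Q) (∣-⊛ Q G∣v)) G∣R)
    open ≐-Reasoning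
    comb : t ⊛ u ⊕ (s ⊕ t ⊛ (-ₚ Q)) ⊛ v ≐ G
    comb = begin
      t ⊛ u ⊕ (s ⊕ t ⊛ (-ₚ Q)) ⊛ v                ≈⟨ ⊕-cong (⊛-congʳ t u≐Qv+R) ≐-refl ⟩
      t ⊛ (Q ⊛ v ⊕ R) ⊕ (s ⊕ t ⊛ (-ₚ Q)) ⊛ v      ≈⟨ PS.solve 6 (λ t Q v R s Q⁻ →
                                                       t PS.:* (Q PS.:* v PS.:+ R) PS.:+ (s PS.:+ t PS.:* Q⁻) PS.:* v
                                                       PS.:= (t PS.:* v) PS.:* (Q PS.:+ Q⁻) PS.:+ (s PS.:* v PS.:+ t PS.:* R))
                                                       ≐-refl t Q v R s (-ₚ Q) ⟩
      (t ⊛ v) ⊛ (Q ⊕ (-ₚ Q)) ⊕ (s ⊛ v ⊕ t ⊛ R)    ≈⟨ ⊕-cong (≐-trans (⊛-congʳ (t ⊛ v) (⊕-inverseʳ Q)) (⊛-zeroʳ (t ⊛ v))) e ⟩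
      G                                           ∎

  unit : ∀ {G} → len G ≡ 1 → ∃ λ G⁻¹ → G⁻¹ ⊛ G ≐ 𝟙
  unit {G} l with D ← len⇒Deg {G} l with c , e ← inverse (coef G 0) (lead≢0 D) =
    const c , ≐-trans (const-⊛ c G) (coefwise λ
      { zero    → trans (coef-· c G 0) (trans (*-comm c _) e)
      ; (suc n) → trans (coef-· c G (suc n)) (trans (cong (c *_) (below D (suc n) (s≤s z≤n))) (zeroʳ c)) })

  -- A Bezout certificate rather than the absence of common divisors, since its coefficient `s` is
  -- an inverse of `u` modulo `p`.
  Coprime : Poly → Poly → Set
  Coprime p u = ∃ λ s → ∃ λ t → s ⊛ u ⊕ t ⊛ p ≐ 𝟙

  irreducible⇒Deg : ∀ {p} → Irreducible p → ∃ λ d → Deg p (suc d)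
  irreducible⇒Deg {p} (2≤len , _) with len p in eq
  irreducible⇒Deg {p} (s≤s (s≤s _) , _) | suc (suc d) = d , len⇒Deg {p} eq

  -- The gcd `G` of `u` and `p` splits `p` as G h. If `G` is a unit, rescaling the combination gives
  -- 1; if `h` is a unit, then `p` is an associate of `G` and divides `u`.
  divides-or-coprime : ∀ {p} → Irreducible p → ∀ u → p ∣ u ⊎ Coprime p u
  divides-or-coprime {p} irr@(_ , split) u
    with _ , D ← irreducible⇒Deg irr
    with G , (k , u≐Gk) , (h , p≐Gh) , s , t , e ← bezout _ u p (below D)
    with split G h (≐⇒≈ₚ p (G ⊛ h) p≐Gh)
  ... | inj₁ lenG with G⁻¹ , f ← unit {G} lenG =
    inj₂ (G⁻¹ ⊛ s , G⁻¹ ⊛ t , (begin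
      (G⁻¹ ⊛ s) ⊛ u ⊕ (G⁻¹ ⊛ t) ⊛ p  ≈⟨ PS.solve 5 (λ g s u t p →
                                        (g PS.:* s) PS.:* u PS.:+ (g PS.:* t) PS.:* p PS.:= g PS.:* (s PS.:* u PS.:+ t PS.:* p))
                                        ≐-refl G⁻¹ s u t p ⟩
      G⁻¹ ⊛ (s ⊛ u ⊕ t ⊛ p)          ≈⟨ ⊛-congʳ G⁻¹ e ⟩
      G⁻¹ ⊛ G                        ≈⟨ f ⟩
      𝟙                              ∎))
    where open ≐-Reasoning
  ... | inj₂ lenh with h⁻¹ , f ← unit {h} lenh =
    inj₁ (h⁻¹ ⊛ k , (begin
      u                    ≈⟨ u≐Gk ⟩
      G ⊛ k                ≈⟨ ⊛-identityˡ _ ⟨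
      𝟙 ⊛ (G ⊛ k)          ≈⟨ ⊛-congˡ (G ⊛ k) f ⟨
      (h⁻¹ ⊛ h) ⊛ (G ⊛ k)  ≈⟨ PS.solve 4 (λ i h g k → (i PS.:* h) PS.:* (g PS.:* k) PS.:= (g PS.:* h) PS.:* (i PS.:* k)) ≐-refl h⁻¹ h G k ⟩
      (G ⊛ h) ⊛ (h⁻¹ ⊛ k)  ≈⟨ ⊛-congˡ (h⁻¹ ⊛ k) p≐Gh ⟨
      p ⊛ (h⁻¹ ⊛ k)        ∎))
    where open ≐-Reasoning

  irreducible-prime : ∀ {p} → Irreducible p → ∀ u v → p ∣ u ⊛ v → p ∣ u ⊎ p ∣ v
  irreducible-prime {p} irr u v (h , uv≐ph) with divides-or-coprime irr u
  ... | inj₁ p∣u = inj₁ p∣u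
  ... | inj₂ (s , t , e) = inj₂ (s ⊛ h ⊕ t ⊛ v , (begin
    v                            ≈⟨ ⊛-identityˡ v ⟨
    𝟙 ⊛ v                        ≈⟨ ⊛-congˡ v e ⟨
    (s ⊛ u ⊕ t ⊛ p) ⊛ v          ≈⟨ PS.solve 5 (λ s u t p v → (s PS.:* u PS.:+ t PS.:* p) PS.:* v PS.:= s PS.:* (u PS.:* v) PS.:+ t PS.:* p PS.:* v) ≐-refl s u t p v ⟩
    s ⊛ (u ⊛ v) ⊕ t ⊛ p ⊛ v      ≈⟨ ⊕-cong (⊛-congʳ s uv≐ph) ≐-refl ⟩
    s ⊛ (p ⊛ h) ⊕ t ⊛ p ⊛ v      ≈⟨ PS.solve 5 (λ s h t p v → s PS.:* (p PS.:* h) PS.:+ t PS.:* p PS.:* v PS.:= p PS.:* (s PS.:* h PS.:+ t PS.:* v)) ≐-refl s h t p v ⟩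
    p ⊛ (s ⊛ h ⊕ t ⊛ v)          ∎))
    where open ≐-Reasoning

  -- Squaring the certificate: 1 = (su + tp)² = w u + p² t², and multiplying by `v` leaves two
  -- multiples of p².
  coprime-square-cancel : ∀ {p u v} → Coprime p u → p ⊛ p ∣ u ⊛ v → p ⊛ p ∣ v
  coprime-square-cancel {p} {u} {v} (s , t , e) (h , uv≐pph) = w ⊛ h ⊕ t ⊛ t ⊛ v , (begin
    v                                           ≈⟨ ⊛-identityˡ v ⟨
    𝟙 ⊛ v                                       ≈⟨ ⊛-congˡ v (⊛-identityˡ 𝟙) ⟨
    (𝟙 ⊛ 𝟙) ⊛ v                                 ≈⟨ ⊛-congˡ v (⊛-cong e e) ⟨
    ((s ⊛ u ⊕ t ⊛ p) ⊛ (s ⊛ u ⊕ t ⊛ p)) ⊛ v     ≈⟨ PS.solve 5 (λ s u t p v →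
                                                      let x = s PS.:* u PS.:+ t PS.:* p in
                                                      (x PS.:* x) PS.:* v PS.:=
                                                      (s PS.:* x PS.:+ t PS.:* p PS.:* s) PS.:* (u PS.:* v) PS.:+ (p PS.:* p) PS.:* (t PS.:* t PS.:* v))
                                                      ≐-refl s u t p v ⟩
    w ⊛ (u ⊛ v) ⊕ (p ⊛ p) ⊛ (t ⊛ t ⊛ v)         ≈⟨ ⊕-cong (⊛-congʳ w uv≐pph) ≐-refl ⟩
    w ⊛ ((p ⊛ p) ⊛ h) ⊕ (p ⊛ p) ⊛ (t ⊛ t ⊛ v)   ≈⟨ PS.solve 4 (λ w q h z → w PS.:* (q PS.:* h) PS.:+ q PS.:* z PS.:= q PS.:* (w PS.:* h PS.:+ z)) ≐-refl w (p ⊛ p) h (t ⊛ t ⊛ v) ⟩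
    (p ⊛ p) ⊛ (w ⊛ h ⊕ t ⊛ t ⊛ v)               ∎)
    where
    w = s ⊛ (s ⊛ u ⊕ t ⊛ p) ⊕ t ⊛ p ⊛ s
    open ≐-Reasoning

  -- Applied first to a · (bc) and then to b · c, with primality splitting p ∣ bc, this yields
  -- exactly the six ways for `f` to fail.
  square-divides-product : ∀ {p} → Irreducible p → ∀ u v → p ⊛ p ∣ u ⊛ v →
                           p ⊛ p ∣ u ⊎ p ⊛ p ∣ v ⊎ (p ∣ u × p ∣ v)
  square-divides-product irr u v pp∣uv with divides-or-coprime irr u | divides-or-coprime irr v
  ... | inj₂ cop | _        = inj₂ (inj₁ (coprime-square-cancel cop pp∣uv))
  ... | inj₁ _   | inj₂ cop = inj₁ (coprime-square-cancel cop (∣-resp-≐ (⊛-comm u v) pp∣uv))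
  ... | inj₁ p∣u | inj₁ p∣v = inj₂ (inj₂ (p∣u , p∣v))

  ∣-trans : ∀ {p u v} → p ∣ u → u ∣ v → p ∣ v
  ∣-trans {p} {u} {v} (h , u≐ph) (k , v≐uk) = h ⊛ k , (≐-trans v≐uk (≐-trans (⊛-congˡ k u≐ph) (⊛-assoc p h k)))

  ∣-square : ∀ {s p} → s ∣ p → s ⊛ s ∣ p ⊛ p
  ∣-square {s} {p} (h , e) = h ⊛ h , ≐-trans (⊛-cong e e)
    (PS.solve 2 (λ s h → (s PS.:* h) PS.:* (s PS.:* h) PS.:= (s PS.:* s) PS.:* (h PS.:* h)) ≐-refl s h)

  quotient-Deg : ∀ {s d u x n} → Deg s d → Below u n → ¬ (u ≐ []) → u ≐ s ⊛ x → ∃ λ e → Deg x e × d ℕ.+ e < n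
  quotient-Deg {s} {x = x} D b u≢0 u≐sx with zero-or-Deg x
  ... | inj₁ x≐0     = contradiction (≐-trans u≐sx (≐-trans (⊛-congʳ s x≐0) (⊛-zeroʳ s))) u≢0
  ... | inj₂ (e , E) = e , E , Deg⇒< (Deg-⊛ D E) (Below-resp-≐ u≐sx b)

  -- Limits the cofactors of a divisor of degree `d` to `n ∸ d` coefficients, which is what makes
  -- multiples countable.
  quotient-Below : ∀ {s d u x n} → Deg s d → Below u n → ¬ (u ≐ []) → u ≐ s ⊛ x → Below x (n ∸ d)
  quotient-Below {d = d} {x = x} D b u≢0 u≐sx with e , E , d+e<n ← quotient-Deg D b u≢0 u≐sx =
    Below-mono {x} (m+n≤o⇒m≤o∸n (suc e) (≤-trans (s≤s (≤-reflexive (ℕₚ.+-comm e d))) d+e<n)) (below E)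

  divisor-Deg< : ∀ {s d u n} → Deg s d → Below u n → ¬ (u ≐ []) → s ∣ u → d < n
  divisor-Deg< D b u≢0 (x , u≐sx) with e , _ , d+e<n ← quotient-Deg D b u≢0 u≐sx = ≤-trans (s≤s (m≤m+n _ e)) d+e<n

  -- Coefficient vectors and enumerations.

  trunc : ∀ n → Poly → Vec Carrier n
  trunc zero    _       = []
  trunc (suc n) []      = 0# ∷ trunc n []
  trunc (suc n) (a ∷ p) = a ∷ trunc n p

  trunc-cong : ∀ n {p q} → p ≐ q → trunc n p ≡ trunc n q
  trunc-cong zero e = refl
  trunc-cong (suc n) {[]}    {[]}    e = refl
  trunc-cong (suc n) {[]}    {b ∷ q} e = cong₂ _∷_ (at e 0) (trunc-cong n (coefwise (at e ∘ suc)))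
  trunc-cong (suc n) {a ∷ p} {[]}    e = cong₂ _∷_ (at e 0) (trunc-cong n (coefwise (at e ∘ suc)))
  trunc-cong (suc n) {a ∷ p} {b ∷ q} e = cong₂ _∷_ (at e 0) (trunc-cong n (coefwise (at e ∘ suc)))

  trunc-toList : ∀ {n} (v : Vec Carrier n) → trunc n (toList v) ≡ v
  trunc-toList []      = refl
  trunc-toList (a ∷ v) = cong (a ∷_) (trunc-toList v)

  toList-trunc : ∀ n {p} → Below p n → toList (trunc n p) ≐ p
  toList-trunc zero    {p}     b = ≐-sym (Below-zero {p} b)
  toList-trunc (suc n) {[]}    b = ≐-trans (∷-cong refl (toList-trunc n {[]} λ _ _ → refl)) 0∷[]≐[]
  toList-trunc (suc n) {a ∷ p} b = ∷-cong refl (toList-trunc n λ m h → b (suc m) (s≤s h))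

  Below-toList : ∀ {n} (v : Vec Carrier n) → Below (toList v) n
  Below-toList []      m       h       = refl
  Below-toList (a ∷ v) (suc m) (s≤s h) = Below-toList v m h

  monic : ∀ {d} → Vec Carrier d → Poly
  monic v = toList v ++ 𝟙

  monic-trunc : ∀ d {p} → coef p d ≡ 1# → Below p (suc d) → monic (trunc d p) ≐ p
  monic-trunc zero    {p}     l b = coefwise λ { zero → sym l ; (suc n) → sym (b (suc n) (s≤s z≤n)) }
  monic-trunc (suc d) {[]}    l b = contradiction l 0≢1
  monic-trunc (suc d) {a ∷ p} l b = ∷-cong refl (monic-trunc d l λ m h → b (suc m) (s≤s h))

  -- Dividing by the leading coefficient leaves q^d candidate divisors of degree `d` instead of (q -
  -- 1) q^d. At q = 7 the union bound could not afford the extra factor.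
  monic-divisor : ∀ {p d} → Deg p d → ∃ λ (v : Vec Carrier d) → Deg (monic v) d × monic v ∣ p
  monic-divisor {p} {d} D with l⁻¹ , ll⁻¹≡1 ← inverse (coef p d) (lead≢0 D) =
    trunc d s , Deg-resp-≐ (≐-sym s-monic) (deg (λ z → 0≢1 (trans (sym z) s-lead)) s-below) ,
    const (coef p d) , ≐-sym (begin
      monic (trunc d s) ⊛ const (coef p d)   ≈⟨ ⊛-comm (monic (trunc d s)) (const (coef p d)) ⟩
      const (coef p d) ⊛ monic (trunc d s)   ≈⟨ const-⊛ (coef p d) (monic (trunc d s)) ⟩
      coef p d · monic (trunc d s)           ≈⟨ ·-cong refl s-monic ⟩
      coef p d · (l⁻¹ · p)                   ≈⟨ ·-· (coef p d) l⁻¹ p ⟩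
      (coef p d * l⁻¹) · p                   ≈⟨ ·-cong ll⁻¹≡1 ≐-refl ⟩
      1# · p                                 ≈⟨ 1· p ⟩
      p                                      ∎)
    where
    s = l⁻¹ · p
    s-lead : coef s d ≡ 1#
    s-lead = trans (coef-· l⁻¹ p d) (trans (*-comm l⁻¹ _) ll⁻¹≡1)
    s-below : Below s (suc d)
    s-below m h = trans (coef-· l⁻¹ p m) (trans (cong (l⁻¹ *_) (below D m h)) (zeroʳ l⁻¹))
    s-monic : monic (trunc d s) ≐ s
    s-monic = monic-trunc d s-lead s-below
    open ≐-Reasoning

  elements : List Carrier
  elements = tabulate (Inverse.from enum)

  ∈-elements : ∀ x → x ∈ elements
  ∈-elements x = subst (_∈ elements) (Inverse.strictlyInverseʳ enum x) (∈-tabulate⁺ {f = Inverse.from enum} (Inverse.to enum x))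

  vectors : ∀ n → List (Vec Carrier n)
  vectors zero    = [] ∷ []
  vectors (suc n) = cartesianProductWith _∷_ elements (vectors n)

  ∈-vectors : ∀ {n} (v : Vec Carrier n) → v ∈ vectors n
  ∈-vectors []      = here refl
  ∈-vectors (a ∷ v) = ∈-cartesianProductWith⁺ _∷_ (∈-elements a) (∈-vectors v)

  length-vectors : ∀ n → length (vectors n) ≡ size ^ n
  length-vectors zero    = refl
  length-vectors (suc n) = trans (length-cartesianProductWith _∷_ elements (vectors n))
    (cong₂ ℕ._*_ (length-tabulate (Inverse.from enum)) (length-vectors n))

  vectors-unique : ∀ n → Unique (vectors n)
  vectors-unique zero    = [] ∷ []
  vectors-unique (suc n) = Unique.cartesianProductWith⁺ _∷_ Vec.∷-injective
    (Unique.tabulate⁺ λ {i} {j} e → trans (sym (Inverse.strictlyInverseˡ enum i))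
      (trans (cong (Inverse.to enum) e) (Inverse.strictlyInverseˡ enum j)))
    (vectors-unique n)

  -- Counting multiples of squares and pairs with a common divisor.

  monics : ℕ → List Poly
  monics d = map monic (vectors d)

  ∈-monics : ∀ {d} (v : Vec Carrier d) → monic v ∈ monics d
  ∈-monics v = ∈-map⁺ monic (∈-vectors v)

  length-monics : ∀ d → length (monics d) ≡ size ^ d
  length-monics d = trans (length-map monic (vectors d)) (length-vectors d)

  -- Without the test, `r ∸ (d ℕ.+ d)` would be cut off at 0 for 2d > r, and the q^d entries would
  -- exceed the bound q^(r - d). In that range s² divides no non-zero residue.
  square-multiples : ∀ r d → List (Vec Carrier r)
  square-multiples r d with d ℕ.+ d ≤? r
  ... | yes _ = cartesianProductWith (λ s z → trunc r ((s ⊛ s) ⊛ toList z)) (monics d) (vectors (r ∸ (d ℕ.+ d)))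
  ... | no  _ = []

  common-multiples : ∀ r d → List (Vec Carrier r × Vec Carrier r)
  common-multiples r d = cartesianProductWith (λ { s (x , y) → trunc r (s ⊛ toList x) , trunc r (s ⊛ toList y) })
    (monics d) (cartesianProduct (vectors (r ∸ d)) (vectors (r ∸ d)))

  -- q^d choices of `s` times q^(r - 2d) cofactors. The factor 1 is the constant `c` of `length-⋃₁`.
  length-square-multiples : ∀ r d → length (square-multiples r d) ≤ 1 ℕ.* size ^ (r ∸ d)
  length-square-multiples r d with d ℕ.+ d ≤? r
  ... | no  _    = z≤n
  ... | yes 2d≤r = ≤-reflexive (begin
    length (cartesianProductWith _ (monics d) (vectors (r ∸ (d ℕ.+ d)))) ≡⟨ length-cartesianProductWith _ (monics d) (vectors (r ∸ (d ℕ.+ d))) ⟩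
    length (monics d) ℕ.* length (vectors (r ∸ (d ℕ.+ d)))  ≡⟨ cong₂ ℕ._*_ (length-monics d) (length-vectors (r ∸ (d ℕ.+ d))) ⟩
    size ^ d ℕ.* size ^ (r ∸ (d ℕ.+ d))                     ≡⟨ ^-distribˡ-+-* size d (r ∸ (d ℕ.+ d)) ⟨
    size ^ (d ℕ.+ (r ∸ (d ℕ.+ d)))                          ≡⟨ cong (λ e → size ^ (d ℕ.+ e)) (∸-+-assoc r d d) ⟨
    size ^ (d ℕ.+ (r ∸ d ∸ d))                              ≡⟨ cong (size ^_) (m+[n∸m]≡n (m+n≤o⇒m≤o∸n d 2d≤r)) ⟩
    size ^ (r ∸ d)                                          ≡⟨ ℕₚ.*-identityˡ (size ^ (r ∸ d)) ⟨
    1 ℕ.* size ^ (r ∸ d)                                    ∎)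
    where open ≡-Reasoning

  -- q^d choices of `s` times q^(r - d) cofactors for each coordinate; here the constant `c` of
  -- `length-⋃₁` is q^r.
  length-common-multiples : ∀ r d → d ≤ r → length (common-multiples r d) ≤ size ^ r ℕ.* size ^ (r ∸ d)
  length-common-multiples r d d≤r = ≤-reflexive (begin
    length (common-multiples r d)       ≡⟨ length-cartesianProductWith _ (monics d) (cartesianProduct (vectors (r ∸ d)) (vectors (r ∸ d))) ⟩
    length (monics d) ℕ.* length (cartesianProduct (vectors (r ∸ d)) (vectors (r ∸ d)))
      ≡⟨ cong₂ ℕ._*_ (length-monics d) (trans (length-cartesianProductWith _,_ (vectors (r ∸ d)) (vectors (r ∸ d)))
           (cong₂ ℕ._*_ (length-vectors (r ∸ d)) (length-vectors (r ∸ d)))) ⟩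
    size ^ d ℕ.* (size ^ (r ∸ d) ℕ.* size ^ (r ∸ d))   ≡⟨ ℕₚ.*-assoc (size ^ d) _ _ ⟨
    size ^ d ℕ.* size ^ (r ∸ d) ℕ.* size ^ (r ∸ d)     ≡⟨ cong (ℕ._* size ^ (r ∸ d)) (^-distribˡ-+-* size d (r ∸ d)) ⟨
    size ^ (d ℕ.+ (r ∸ d)) ℕ.* size ^ (r ∸ d)          ≡⟨ cong (λ e → size ^ e ℕ.* size ^ (r ∸ d)) (m+[n∸m]≡n d≤r) ⟩
    size ^ r ℕ.* size ^ (r ∸ d)                        ∎)
    where open ≡-Reasoning

  -- An upper bound only: 0 occurs, and reducible `s` are included. The union stops at `m` because
  -- divisors of a non-zero residue have degree at most `m`.
  non-squarefree : ∀ m → List (Vec Carrier (suc m))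
  non-squarefree m = ⋃₁ (square-multiples (suc m)) m

  non-coprime : ∀ m → List (Vec Carrier (suc m) × Vec Carrier (suc m))
  non-coprime m = ⋃₁ (common-multiples (suc m)) m

  -- Shows that the lists of multiples are complete: the cofactor of a non-zero residue is short
  -- enough to survive truncation to `r ∸ d` coefficients.
  trunc-multiple : ∀ {r s k d} (a : Vec Carrier r) → Deg k d → ¬ (toList a ≐ []) → toList a ≐ k ⊛ s →
                   trunc r (k ⊛ toList (trunc (r ∸ d) s)) ≡ a
  trunc-multiple {r} {s} {k} {d} a D a≢0 a≐ks = trans
    (trunc-cong r (≐-trans (⊛-congʳ k (toList-trunc (r ∸ d) (quotient-Below D (Below-toList a) a≢0 a≐ks))) (≐-sym a≐ks)))
    (trunc-toList a)

  monic-square⇒∈-non-squarefree : ∀ {m d} (a : Vec Carrier (suc m)) (v : Vec Carrier d) → 1 ≤ d → Deg (monic v) d →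
    ¬ (toList a ≐ []) → monic v ⊛ monic v ∣ toList a → a ∈ non-squarefree m
  monic-square⇒∈-non-squarefree {m} {d} a v 1≤d S a≢0 ss∣a@(z , a≐ssz) =
    ∈-⋃₁⁺ (square-multiples (suc m)) 1≤d (≤-trans (m≤m+n d d) (s≤s⁻¹ 2d<r)) member
    where
    2d<r : d ℕ.+ d < suc m
    2d<r = divisor-Deg< (Deg-⊛ S S) (Below-toList a) a≢0 ss∣a
    member : a ∈ square-multiples (suc m) d
    member with d ℕ.+ d ≤? suc m
    ... | no  2d≰r = contradiction (<⇒≤ 2d<r) 2d≰r
    ... | yes _    = subst (_∈ _) (trunc-multiple a (Deg-⊛ S S) a≢0 a≐ssz)
      (∈-cartesianProductWith⁺ (λ s z → trunc (suc m) ((s ⊛ s) ⊛ toList z)) (∈-monics v)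
        (∈-vectors (trunc (suc m ∸ (d ℕ.+ d)) z)))

  ∈-non-squarefree : ∀ {m p} (a : Vec Carrier (suc m)) → Irreducible p → ¬ (toList a ≐ []) →
                     p ⊛ p ∣ toList a → a ∈ non-squarefree m
  ∈-non-squarefree a irr a≢0 pp∣a
    with d , D ← irreducible⇒Deg irr
    with v , S , s∣p ← monic-divisor D =
    monic-square⇒∈-non-squarefree a v (s≤s z≤n) S a≢0 (∣-trans (∣-square s∣p) pp∣a)

  ∈-non-coprime : ∀ {m p} (a b : Vec Carrier (suc m)) → Irreducible p → ¬ (toList a ≐ []) → ¬ (toList b ≐ []) →
                  p ∣ toList a → p ∣ toList b → (a , b) ∈ non-coprime m
  ∈-non-coprime {m} {p} a b irr a≢0 b≢0 p∣a p∣b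
    with d , D ← irreducible⇒Deg irr
    with v , S , s∣p ← monic-divisor D
    with s∣a@(x , a≐sx) ← ∣-trans s∣p p∣a
    with y , b≐sy ← ∣-trans s∣p p∣b =
    ∈-⋃₁⁺ (common-multiples (suc m)) (s≤s z≤n) (s≤s⁻¹ (divisor-Deg< S (Below-toList a) a≢0 s∣a))
      (subst (_∈ _) (cong₂ _,_ (trunc-multiple a S a≢0 a≐sx) (trunc-multiple b S b≢0 b≐sy))
        (∈-cartesianProductWith⁺ _ (∈-monics v)
          (∈-cartesianProduct⁺ (∈-vectors (trunc (suc m ∸ suc d) x)) (∈-vectors (trunc (suc m ∸ suc d) y)))))

-- Arithmetic modulo `F`, of degree r = `suc m`.

module ResidueClasses (𝔽 : FiniteField) (7≤size : 7 ≤ FiniteField.size 𝔽) where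
  open FiniteField 𝔽 using (Carrier; 0#; 1#; size; enum)
  open Polynomials 𝔽
  open PolynomialRing 𝔽

  private
    module PR = Algebra.Properties.Ring (CommutativeRing.ring poly-ring)

  module _ (F : Poly) (m : ℕ) (1≤m : 1 ≤ m) (F-irr : Irreducible F) (F-deg : Deg F (suc m)) where

    infix 4 _∼_
    record _∼_ (u v : Poly) : Set where
      constructor modulo
      field
        cofactor : Poly
        equality : u ≐ v ⊕ F ⊛ cofactor

    ≐⇒∼ : ∀ {u v} → u ≐ v → u ∼ v
    ≐⇒∼ {u} {v} e = modulo [] (≐-trans e (≐-sym (≐-trans (⊕-cong (≐-refl {v}) (⊛-zeroʳ F)) (⊕-identityʳ v))))

    ∼-sym : ∀ {u v} → u ∼ v → v ∼ u
    ∼-sym {u} {v} (modulo k e) = modulo (-ₚ k) (≐-sym (begin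
      u ⊕ F ⊛ (-ₚ k)             ≈⟨ ⊕-cong e ≐-refl ⟩
      (v ⊕ F ⊛ k) ⊕ F ⊛ (-ₚ k)   ≈⟨ PS.solve 4 (λ v F k l → (v PS.:+ F PS.:* k) PS.:+ F PS.:* l PS.:= v PS.:+ F PS.:* (k PS.:+ l)) ≐-refl v F k (-ₚ k) ⟩
      v ⊕ F ⊛ (k ⊕ (-ₚ k))       ≈⟨ ⊕-cong (≐-refl {v}) (≐-trans (⊛-congʳ F (⊕-inverseʳ k)) (⊛-zeroʳ F)) ⟩
      v ⊕ []                     ≈⟨ ⊕-identityʳ v ⟩
      v                          ∎))
      where open ≐-Reasoning

    ∼-trans : ∀ {u v w} → u ∼ v → v ∼ w → u ∼ w
    ∼-trans {u} {v} {w} (modulo k e) (modulo l f) = modulo (k ⊕ l) (begin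
      u                      ≈⟨ e ⟩
      v ⊕ F ⊛ k              ≈⟨ ⊕-cong f ≐-refl ⟩
      (w ⊕ F ⊛ l) ⊕ F ⊛ k    ≈⟨ PS.solve 4 (λ w F k l → (w PS.:+ F PS.:* l) PS.:+ F PS.:* k PS.:= w PS.:+ F PS.:* (k PS.:+ l)) ≐-refl w F k l ⟩
      w ⊕ F ⊛ (k ⊕ l)        ∎)
      where open ≐-Reasoning

    ⊛-cong-∼ : ∀ {u u′ v v′} → u ∼ u′ → v ∼ v′ → u ⊛ v ∼ u′ ⊛ v′
    ⊛-cong-∼ {u} {u′} {v} {v′} (modulo k e) (modulo l f) = modulo (k ⊛ v′ ⊕ u′ ⊛ l ⊕ k ⊛ (F ⊛ l)) (begin
      u ⊛ v                            ≈⟨ ⊛-cong e f ⟩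
      (u′ ⊕ F ⊛ k) ⊛ (v′ ⊕ F ⊛ l)      ≈⟨ PS.solve 5 (λ u v F k l → (u PS.:+ F PS.:* k) PS.:* (v PS.:+ F PS.:* l)
                                           PS.:= u PS.:* v PS.:+ F PS.:* (k PS.:* v PS.:+ u PS.:* l PS.:+ k PS.:* (F PS.:* l))) ≐-refl u′ v′ F k l ⟩
      u′ ⊛ v′ ⊕ F ⊛ (k ⊛ v′ ⊕ u′ ⊛ l ⊕ k ⊛ (F ⊛ l))  ∎)
      where open ≐-Reasoning

    ∼⇒∣- : ∀ {u v} → u ∼ v → F ∣ u -ₚ v
    ∼⇒∣- {u} {v} (modulo k e) = k , (begin
      u ⊕ (-ₚ v)              ≈⟨ ⊕-cong e ≐-refl ⟩
      (v ⊕ F ⊛ k) ⊕ (-ₚ v)    ≈⟨ PS.solve 3 (λ v w x → (v PS.:+ w) PS.:+ x PS.:= w PS.:+ (v PS.:+ x)) ≐-refl v (F ⊛ k) (-ₚ v) ⟩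
      F ⊛ k ⊕ (v ⊕ (-ₚ v))    ≈⟨ ⊕-cong (≐-refl {F ⊛ k}) (⊕-inverseʳ v) ⟩
      F ⊛ k ⊕ []              ≈⟨ ⊕-identityʳ (F ⊛ k) ⟩
      F ⊛ k                   ∎)
      where open ≐-Reasoning

    F∤small : ∀ {u} → Below u (suc m) → ¬ (u ≐ []) → ¬ (F ∣ u)
    F∤small b u≢0 F∣u = <-irrefl refl (divisor-Deg< F-deg b u≢0 F∣u)

    -- The difference is a multiple of `F` of smaller degree than `F`, hence zero. So a class has
    -- only one short representative.
    small-∼⇒≐ : ∀ {u v} → Below u (suc m) → Below v (suc m) → u ∼ v → u ≐ v
    small-∼⇒≐ {u} {v} bu bv u∼v with zero-or-Deg (u -ₚ v)
    ... | inj₁ u-v≐0   = PR.x∙y⁻¹≈ε⇒x≈y u v u-v≐0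
    ... | inj₂ (_ , D) = contradiction (∼⇒∣- u∼v)
      (F∤small (Below-⊕ {u} { -ₚ v} bu (Below-neg {v} bv)) (Deg⇒≢0 D))

    Residue : Set
    Residue = Vec Carrier (suc m)

    ⟦_⟧ : Residue → Poly
    ⟦_⟧ = toList

    abstract
      -- Abstract, so that the division algorithm is never unfolded; `⟦reduce⟧` is all that later
      -- proofs use.
      reduce : Poly → Residue
      reduce u = trunc (suc m) (proj₁ (proj₂ (divide F-deg u)))

      ⟦reduce⟧ : ∀ u → ⟦ reduce u ⟧ ∼ u
      ⟦reduce⟧ u with Q , R , e , b ← divide F-deg u =
        ∼-trans (≐⇒∼ (toList-trunc (suc m) {R} b))
          (∼-sym (modulo Q (≐-trans e (≐-trans (⊕-comm (Q ⊛ F) R) (⊕-cong (≐-refl {R}) (⊛-comm Q F))))))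

    reduce-unique : ∀ (a : Residue) {u} → ⟦ a ⟧ ∼ u → a ≡ reduce u
    reduce-unique a {u} a∼u = begin
      a                                ≡⟨ trunc-toList a ⟨
      trunc (suc m) ⟦ a ⟧              ≡⟨ trunc-cong (suc m) (small-∼⇒≐ (Below-toList a) (Below-toList (reduce u))
                                            (∼-trans a∼u (∼-sym (⟦reduce⟧ u)))) ⟩
      trunc (suc m) ⟦ reduce u ⟧       ≡⟨ trunc-toList (reduce u) ⟩
      reduce u                         ∎
      where open ≡-Reasoning

    NonZero : Residue → Set
    NonZero a = ¬ (⟦ a ⟧ ≐ [])

    abstract
      -- Junk value [] on multiples of F.
      inv : Poly → Poly
      inv u with divides-or-coprime F-irr u
      ... | inj₁ _       = []
      ... | inj₂ (s , _) = s

      inverseʳ : ∀ a → NonZero a → ⟦ a ⟧ ⊛ inv ⟦ a ⟧ ∼ 𝟙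
      inverseʳ a a≢0 with divides-or-coprime F-irr ⟦ a ⟧
      ... | inj₁ F∣a         = contradiction F∣a (F∤small (Below-toList a) a≢0)
      ... | inj₂ (s , t , e) = ∼-sym (modulo t (≐-trans (≐-sym e) (⊕-cong (⊛-comm s ⟦ a ⟧) (⊛-comm t F))))

    -- The residue completing two given ones to a product in the class of `g`.

    module _ (g : Poly) (F∤g : ¬ (F ∣ g)) where

      third : Residue → Residue → Residue
      third a b = reduce (g ⊛ (inv ⟦ a ⟧ ⊛ inv ⟦ b ⟧))

      third-product : ∀ {a b} → NonZero a → NonZero b → ⟦ a ⟧ ⊛ (⟦ b ⟧ ⊛ ⟦ third a b ⟧) ∼ g
      third-product {a} {b} a≢0 b≢0 =
        ∼-trans (⊛-cong-∼ (≐⇒∼ (≐-refl {A})) (⊛-cong-∼ (≐⇒∼ (≐-refl {B})) (⟦reduce⟧ (g ⊛ (A′ ⊛ B′)))))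
        (∼-trans (≐⇒∼ (PS.solve 5 (λ a b a′ b′ g → a PS.:* (b PS.:* (g PS.:* (a′ PS.:* b′))) PS.:= (a PS.:* a′) PS.:* ((b PS.:* b′) PS.:* g)) ≐-refl A B A′ B′ g))
        (∼-trans (⊛-cong-∼ (inverseʳ a a≢0) (⊛-cong-∼ (inverseʳ b b≢0) (≐⇒∼ (≐-refl {g}))))
                 (≐⇒∼ (≐-trans (⊛-identityˡ (𝟙 ⊛ g)) (⊛-identityˡ g)))))
        where
        A = ⟦ a ⟧
        B = ⟦ b ⟧
        A′ = inv A
        B′ = inv B

      -- The relation abc ∼ g is symmetric, so by cancellation any two of the three residues
      -- determine the remaining one. This is how counts over (a, c) or (b, c) become counts over
      -- (a, b).
      third-unique : ∀ {a b c} → NonZero a → NonZero b → ⟦ a ⟧ ⊛ (⟦ b ⟧ ⊛ ⟦ c ⟧) ∼ g → c ≡ third a b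
      third-unique {a} {b} {c} a≢0 b≢0 abc∼g = reduce-unique c (∼-sym
        (∼-trans (⊛-cong-∼ (∼-sym abc∼g) (≐⇒∼ (≐-refl {A′ ⊛ B′})))
        (∼-trans (≐⇒∼ (PS.solve 5 (λ a b a′ b′ c → (a PS.:* (b PS.:* c)) PS.:* (a′ PS.:* b′) PS.:= (a PS.:* a′) PS.:* ((b PS.:* b′) PS.:* c)) ≐-refl A B A′ B′ ⟦ c ⟧))
        (∼-trans (⊛-cong-∼ (inverseʳ a a≢0) (⊛-cong-∼ (inverseʳ b b≢0) (≐⇒∼ (≐-refl {⟦ c ⟧}))))
                 (≐⇒∼ (≐-trans (⊛-identityˡ (𝟙 ⊛ ⟦ c ⟧)) (⊛-identityˡ ⟦ c ⟧)))))))
        where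
        A = ⟦ a ⟧
        B = ⟦ b ⟧
        A′ = inv A
        B′ = inv B

      third-nonzero : ∀ {a b} → NonZero a → NonZero b → NonZero (third a b)
      third-nonzero {a} {b} a≢0 b≢0 c≐0 = F∤g (∣-resp-≐ (≐-sym (_∼_.equality g∼0)) (_ , ≐-refl))
        where
        g∼0 : g ∼ []
        g∼0 = ∼-trans (∼-sym (third-product a≢0 b≢0)) (≐⇒∼
          (≐-trans (⊛-congʳ ⟦ a ⟧ (≐-trans (⊛-congʳ ⟦ b ⟧ c≐0) (⊛-zeroʳ ⟦ b ⟧))) (⊛-zeroʳ ⟦ a ⟧)))

      -- The excluded pairs and their number.

      residues constants zeros : List Residue
      residues  = vectors (suc m)
      constants = map (trunc (suc m) ∘ const) elements
      zeros     = trunc (suc m) [] ∷ []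

      -- These carry (a, c) and (b, c) back to (a, b). Mapping preserves the length of a list, so
      -- injectivity never enters, nor do the values at zero residues, which are excluded
      -- separately.
      with-third swap-third : Residue × Residue → Residue × Residue
      with-third (a , c) = a , third a c
      swap-third (b , c) = third b c , b

      -- In order: squares in `a`, `b`, `c`; common divisors of `a` and `b`, of `a` and `c`, of `b`
      -- and `c`; a zero coordinate; two constants.
      bad : List (Residue × Residue)
      bad = cartesianProduct (non-squarefree m) residues
         ++ cartesianProduct residues (non-squarefree m)
         ++ map with-third (cartesianProduct residues (non-squarefree m))
         ++ non-coprime m
         ++ map with-third (non-coprime m)
         ++ map swap-third (non-coprime m)
         ++ cartesianProduct zeros residues
         ++ cartesianProduct residues zeros
         ++ cartesianProduct constants constants

      length-bad : length bad < size ^ suc m ℕ.* size ^ suc m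
      length-bad = ≤-trans (s≤s (≤-reflexive count)) (union-bound (length (non-squarefree m)) (length (non-coprime m)) 7≤size
        -- The assumption r ≥ 2 enters here: q ≤ q^m, hence q² ≤ q^r.
        (*-monoʳ-≤ size (≤-trans (≤-reflexive (sym (^-identityʳ size))) (^-monoʳ-≤ size {{ℕ.>-nonZero (≤-trans (s≤s z≤n) 7≤size)}} 1≤m)))
        -- Stopping at degree `m` = r - 1 leaves the remainder q^(r - m) = q.
        (subst₂ _≤_ (cong (6 ℕ.* length (non-squarefree m) ℕ.+_) (trans (ℕₚ.*-identityˡ _) q^1)) (ℕₚ.*-identityˡ _)
          (length-⋃₁ 7≤size 1 (suc m) (square-multiples (suc m)) m (n≤1+n m) (λ d _ → length-square-multiples (suc m) d)))
        (subst₂ _≤_ (cong (λ x → 6 ℕ.* length (non-coprime m) ℕ.+ size ^ suc m ℕ.* x) q^1) refl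
          (length-⋃₁ 7≤size (size ^ suc m) (suc m) (common-multiples (suc m)) m (n≤1+n m)
            (λ d d≤m → length-common-multiples (suc m) d (m≤n⇒m≤1+n d≤m)))))
        where
        q^1 : size ^ (suc m ∸ m) ≡ size
        q^1 = trans (cong (size ^_) (m+n∸n≡m 1 m)) (^-identityʳ size)

        append : ∀ (xs ys : List (Residue × Residue)) {k l} → length xs ≡ k → length ys ≡ l → length (xs ++ ys) ≡ k ℕ.+ l
        append xs ys e f = trans (length-++ xs) (cong₂ ℕ._+_ e f)

        product : ∀ (xs ys : List Residue) {k l} → length xs ≡ k → length ys ≡ l → length (cartesianProduct xs ys) ≡ k ℕ.* l
        product xs ys e f = trans (length-cartesianProductWith _,_ xs ys) (cong₂ ℕ._*_ e f)

        #residues = length-vectors (suc m)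
        #constants : length constants ≡ size
        #constants = trans (length-map _ elements) (length-tabulate (Inverse.from enum))

        count : length bad ≡ _
        count = append (cartesianProduct (non-squarefree m) residues) _ (product (non-squarefree m) residues refl #residues)
          (append (cartesianProduct residues (non-squarefree m)) _ (product residues (non-squarefree m) #residues refl)
          (append (map with-third (cartesianProduct residues (non-squarefree m))) _
                  (trans (length-map with-third (cartesianProduct residues (non-squarefree m))) (product residues (non-squarefree m) #residues refl))
          (append (non-coprime m) _ refl
          (append (map with-third (non-coprime m)) _ (length-map with-third (non-coprime m))
          (append (map swap-third (non-coprime m)) _ (length-map swap-third (non-coprime m))
          (append (cartesianProduct zeros residues) _ (product zeros residues refl #residues)
          (append (cartesianProduct residues zeros) _ (product residues zeros #residues refl)
                  (product constants constants #constants #constants))))))))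

      record Good (a b : Residue) : Set where
        c = third a b
        field
          a≢0 : NonZero a
          b≢0 : NonZero b
          a-squarefree : a ∉ non-squarefree m
          b-squarefree : b ∉ non-squarefree m
          c-squarefree : c ∉ non-squarefree m
          ab-coprime : (a , b) ∉ non-coprime m
          ac-coprime : (a , c) ∉ non-coprime m
          bc-coprime : (b , c) ∉ non-coprime m
          not-both-constant : ¬ (a ∈ constants × b ∈ constants)

      -- Conditions on `c` are pulled back by writing `b` as `third a c` or `a` as `third b c`,
      -- which exhibits (a, b) in the image of `with-third` or `swap-third`.
      ∉bad⇒Good : ∀ a b → (a , b) ∉ bad → Good a b
      ∉bad⇒Good a b ∉bad = record
        { a≢0 = a≢0
        ; b≢0 = b≢0
        ; a-squarefree = λ a∈ → ∉bad (∈-++⁺ˡ (∈-cartesianProduct⁺ a∈ (∈-vectors b)))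
        ; b-squarefree = λ b∈ → ∉₁ (∈-++⁺ˡ (∈-cartesianProduct⁺ (∈-vectors a) b∈))
        ; c-squarefree = λ c∈ → ∉₂ (∈-++⁺ˡ (subst (_∈ _) (cong (a ,_) (sym b≡)) (∈-map⁺ with-third (∈-cartesianProduct⁺ (∈-vectors a) c∈))))
        ; ab-coprime = λ ab∈ → ∉₃ (∈-++⁺ˡ ab∈)
        ; ac-coprime = λ ac∈ → ∉₄ (∈-++⁺ˡ (subst (_∈ _) (cong (a ,_) (sym b≡)) (∈-map⁺ with-third ac∈)))
        ; bc-coprime = λ bc∈ → ∉₅ (∈-++⁺ˡ (subst (_∈ _) (cong (_, b) (sym a≡)) (∈-map⁺ swap-third bc∈)))
        ; not-both-constant = λ (a∈ , b∈) → ∉₈ (∈-cartesianProduct⁺ a∈ b∈)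
        }
        where
        ∉₁ = ∉bad ∘ ∈-++⁺ʳ (cartesianProduct (non-squarefree m) residues)
        ∉₂ = ∉₁ ∘ ∈-++⁺ʳ (cartesianProduct residues (non-squarefree m))
        ∉₃ = ∉₂ ∘ ∈-++⁺ʳ (map with-third (cartesianProduct residues (non-squarefree m)))
        ∉₄ = ∉₃ ∘ ∈-++⁺ʳ (non-coprime m)
        ∉₅ = ∉₄ ∘ ∈-++⁺ʳ (map with-third (non-coprime m))
        ∉₆ = ∉₅ ∘ ∈-++⁺ʳ (map swap-third (non-coprime m))
        ∉₇ = ∉₆ ∘ ∈-++⁺ʳ (cartesianProduct zeros residues)
        ∉₈ = ∉₇ ∘ ∈-++⁺ʳ (cartesianProduct residues zeros)

        ∈-zeros : ∀ {x : Residue} → ⟦ x ⟧ ≐ [] → x ∈ zeros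
        ∈-zeros {x} x≐0 = here (trans (sym (trunc-toList x)) (trunc-cong (suc m) x≐0))

        a≢0 : NonZero a
        a≢0 a≐0 = ∉₆ (∈-++⁺ˡ (∈-cartesianProduct⁺ (∈-zeros a≐0) (∈-vectors b)))
        b≢0 : NonZero b
        b≢0 b≐0 = ∉₇ (∈-++⁺ˡ (∈-cartesianProduct⁺ (∈-vectors a) (∈-zeros b≐0)))

        abc∼g = third-product a≢0 b≢0
        c≢0 = third-nonzero a≢0 b≢0
        C = ⟦ third a b ⟧
        b≡ : b ≡ third a (third a b)
        b≡ = third-unique a≢0 c≢0 (∼-trans (≐⇒∼ (⊛-congʳ ⟦ a ⟧ (⊛-comm C ⟦ b ⟧))) abc∼g)
        a≡ : a ≡ third b (third a b)
        a≡ = third-unique b≢0 c≢0 (∼-trans (≐⇒∼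
          (PS.solve 3 (λ a b c → b PS.:* (c PS.:* a) PS.:= a PS.:* (b PS.:* c)) ≐-refl ⟦ a ⟧ ⟦ b ⟧ C)) abc∼g)

      ∃Good : ∃ λ a → ∃ λ b → Good a b
      ∃Good with (a , b) , ∉bad ← longer⇒∃∉ (Product.≡-dec (Vec.≡-dec _≟_) (Vec.≡-dec _≟_))
        (Unique.cartesianProduct⁺ (vectors-unique (suc m)) (vectors-unique (suc m)))
        (≤-trans length-bad (≤-reflexive (sym (trans (length-cartesianProductWith _,_ residues residues)
          (cong₂ ℕ._*_ (length-vectors (suc m)) (length-vectors (suc m)))))))
        = a , b , ∉bad⇒Good a b ∉bad

      Deg0⇒constant : ∀ {a : Residue} → Deg ⟦ a ⟧ 0 → a ∈ constants
      Deg0⇒constant {a} D = subst (_∈ constants)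
        (trans (trunc-cong (suc m) {const (coef ⟦ a ⟧ 0)} {⟦ a ⟧} (coefwise λ
          { zero → refl ; (suc n) → sym (Deg.below D (suc n) (s≤s z≤n)) })) (trunc-toList a))
        (∈-map⁺ _ (∈-elements (coef ⟦ a ⟧ 0)))

      -- The product of a good triple has all the required properties.

      module _ {a b : Residue} (good : Good a b) where
        open Good good

        c≢0 : NonZero c
        c≢0 = third-nonzero a≢0 b≢0

        f : Poly
        f = ⟦ a ⟧ ⊛ (⟦ b ⟧ ⊛ ⟦ c ⟧)

        divisor-len : ∀ {p} → Irreducible p → (x : Residue) → NonZero x → p ∣ ⟦ x ⟧ → len p ≤ suc m
        divisor-len {p} irr x x≢0 p∣x with d , D ← irreducible⇒Deg irr =
          ≤-trans (≤-reflexive (Deg⇒len D)) (divisor-Deg< D (Below-toList x) x≢0 p∣x)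

        -- No counting is involved: a prime divisor of the product divides a non-zero residue, whose
        -- degree is at most `m`.
        f-smooth : Smooth m f
        f-smooth p irr p∣f
          with irreducible-prime irr ⟦ a ⟧ (⟦ b ⟧ ⊛ ⟦ c ⟧) (∣ₚ⇒∣ {p} {f} p∣f)
        ... | inj₁ p∣a = divisor-len irr a a≢0 p∣a
        ... | inj₂ p∣bc with irreducible-prime irr ⟦ b ⟧ ⟦ c ⟧ p∣bc
        ...   | inj₁ p∣b = divisor-len irr b b≢0 p∣b
        ...   | inj₂ p∣c = divisor-len irr c c≢0 p∣c

        f-squarefree : SquareFree f
        f-squarefree p irr pp∣f
          with square-divides-product irr ⟦ a ⟧ (⟦ b ⟧ ⊛ ⟦ c ⟧) (∣ₚ⇒∣ {p ⊛ p} {f} pp∣f)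
        ... | inj₁ pp∣a = a-squarefree (∈-non-squarefree a irr a≢0 pp∣a)
        ... | inj₂ (inj₁ pp∣bc) with square-divides-product irr ⟦ b ⟧ ⟦ c ⟧ pp∣bc
        ...   | inj₁ pp∣b               = b-squarefree (∈-non-squarefree b irr b≢0 pp∣b)
        ...   | inj₂ (inj₁ pp∣c)        = c-squarefree (∈-non-squarefree c irr c≢0 pp∣c)
        ...   | inj₂ (inj₂ (p∣b , p∣c)) = bc-coprime (∈-non-coprime b c irr b≢0 c≢0 p∣b p∣c)
        f-squarefree p irr pp∣f
            | inj₂ (inj₂ (p∣a , p∣bc)) with irreducible-prime irr ⟦ b ⟧ ⟦ c ⟧ p∣bc
        ...   | inj₁ p∣b = ab-coprime (∈-non-coprime a b irr a≢0 b≢0 p∣a p∣b)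
        ...   | inj₂ p∣c = ac-coprime (∈-non-coprime a c irr a≢0 c≢0 p∣a p∣c)

        -- Degrees add and `c` is non-zero, so positive degree of `a` or of `b` suffices; this is
        -- why excluding pairs of constants is enough.
        f-nonconstant : NonConstant f
        f-nonconstant with zero-or-Deg ⟦ a ⟧ | zero-or-Deg ⟦ b ⟧ | zero-or-Deg ⟦ c ⟧
        ... | inj₁ a≐0 | _ | _ = contradiction a≐0 a≢0
        ... | inj₂ _ | inj₁ b≐0 | _ = contradiction b≐0 b≢0
        ... | inj₂ _ | inj₂ _ | inj₁ c≐0 = contradiction c≐0 c≢0
        ... | inj₂ (suc _ , A) | inj₂ (_ , B) | inj₂ (_ , C) =
          ≤-trans (s≤s (s≤s z≤n)) (≤-reflexive (sym (Deg⇒len (Deg-⊛ A (Deg-⊛ B C)))))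
        ... | inj₂ (zero , A) | inj₂ (suc _ , B) | inj₂ (_ , C) =
          ≤-trans (s≤s (s≤s z≤n)) (≤-reflexive (sym (Deg⇒len (Deg-⊛ A (Deg-⊛ B C)))))
        ... | inj₂ (zero , A) | inj₂ (zero , B) | inj₂ _ =
          contradiction (Deg0⇒constant A , Deg0⇒constant B) not-both-constant

        F∣f-g : F ∣ₚ (f -ₚ g)
        F∣f-g = ∣⇒∣ₚ {F} {f -ₚ g} (∼⇒∣- {f} {g} (third-product a≢0 b≢0))

      representative : Σ Poly λ f → (F ∣ₚ (f -ₚ g)) × NonConstant f × SquareFree f × Smooth m f
      representative = let a , b , good = ∃Good in
        f good , F∣f-g good , f-nonconstant good , f-squarefree good , f-smooth good

theorem1p1 : (𝔽 : FiniteField) → 7 ≤ FiniteField.size 𝔽 →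
    let open Polynomials 𝔽 in
    (F : Poly) (r : ℕ) → 2 ≤ r → Irreducible F → HasDegree F r →
    (g : Poly) → ¬ (F ∣ₚ g) →
    Σ Poly λ f → (F ∣ₚ (f -ₚ g)) × NonConstant f × SquareFree f × Smooth (r ∸ 1) f
theorem1p1 𝔽 7≤q F (suc m) (s≤s 1≤m) irr F-deg g F∤g =
  ResidueClasses.representative 𝔽 7≤q F m 1≤m irr (len⇒Deg {F} F-deg) g (λ F∣g → F∤g (∣⇒∣ₚ {F} {g} F∣g))
  where open PolynomialRing 𝔽
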